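{- Let $\boldsymbol{\mu}=(\mu_1,\ldots,\mu_n)$ be an $n$-tuple of umbral monomials with generating function $f(\boldsymbol{\mu},\boldsymbol{t}_{(n)})$ and let $\{\boldsymbol{\nu}_1,\ldots,\boldsymbol{\nu}_n\}$ be a set of $m$-tuples of umbral monomials with generating functions $f(\boldsymbol{\nu}_i,\boldsymbol{t}_{(m)})$, $i=1,\dots,n$, where $\boldsymbol{t}_{(k)}=(t_1,\dots,t_k)$. Then the auxiliary umbra $\mu_1\boldsymbol{.}\beta\boldsymbol{.}\boldsymbol{\nu}_1+\cdots+\mu_n\boldsymbol{.}\beta\boldsymbol{.}\boldsymbol{\nu}_n$ has generating function $$f[\mu_1\boldsymbol{.}\beta\boldsymbol{.}\boldsymbol{\nu}_1+\cdots+\mu_n\boldsymbol{.}\beta\boldsymbol{.}\boldsymbol{\nu}_n,\,\boldsymbol{t}_{(m)}]=f[\boldsymbol{\mu},(f(\boldsymbol{\nu}_1,\boldsymbol{t}_{(m)})-1,\ldots,f(\boldsymbol{\nu}_n,\boldsymbol{t}_{(m)})-1)],$$ an identity of formal power series in $t_1,\dots,t_m$.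
   Context: $R$ is the real or complex field, $A$ is a set (the alphabet) whose elements are called umbrae, and $E:R[A]\to R$ is a linear functional (evaluation) with $E[1]=1$ and $E[\alpha^i\gamma^j\cdots]=E[\alpha^i]E[\gamma^j]\cdots$ for distinct umbrae and nonnegative integers $i,j,\dots$. A $k$-tuple $\boldsymbol{\mu}=(\mu_1,\dots,\mu_k)$ of umbral monomials (monomials in $R[A]$, supports not necessarily disjoint) has multivariate moments $E[\boldsymbol{\mu}^{\boldsymbol{i}}]$, $\boldsymbol{\mu}^{\boldsymbol{i}}=\mu_1^{i_1}\cdots\mu_k^{i_k}$, $\boldsymbol{i}\in\mathbb{N}_0^k$, and generating function $f(\boldsymbol{\mu},\boldsymbol{t}_{(k)})=1+\sum_{\boldsymbol{i}\neq\boldsymbol{0}}E[\boldsymbol{\mu}^{\boldsymbol{i}}]\,\boldsymbol{t}_{(k)}^{\boldsymbol{i}}/\boldsymbol{i}!$ with $\boldsymbol{i}!=i_1!\cdots i_k!$, $\boldsymbol{t}_{(k)}^{\boldsymbol{i}}=t_1^{i_1}\cdots t_k^{i_k}$. For formal power series $s_1,\dots,s_n$ without constant term, $f[\boldsymbol{\mu},(s_1,\dots,s_n)]$ denotes the substitution $t_j\mapsto s_j$ in $f(\boldsymbol{\mu},\boldsymbol{t}_{(n)})$. Partitions of a multi-index: a partition $\boldsymbol{\lambda}$ of $\boldsymbol{i}\in\mathbb{N}_0^m$, written $\boldsymbol{\lambda}\vdash\boldsymbol{i}$, is a matrix of nonnegative integers with $m$ rows, no zero column, columns in lexicographic order, and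 $r$-th row sum equal to $i_r$ for $r=1,\dots,m$ (for $\boldsymbol{i}=\boldsymbol{0}$ the only partition is the empty one). Its number of columns is $l(\boldsymbol{\lambda})$. Writing $\boldsymbol{\lambda}=(\boldsymbol{\lambda}_1^{r_1},\boldsymbol{\lambda}_2^{r_2},\dots)$ when the distinct column $\boldsymbol{\lambda}_j$ occurs $r_j$ times, set $\mathfrak{m}(\boldsymbol{\lambda})!=r_1!r_2!\cdots$ and $\boldsymbol{\lambda}!=\prod_j(\boldsymbol{\lambda}_j!)^{r_j}$ (product of factorials of all entries). With $h^{(j)}_{\boldsymbol{k}}=E[\boldsymbol{\nu}_j^{\boldsymbol{k}}]$ set $h^{(j)}_{\boldsymbol{\lambda}}=(h^{(j)}_{\boldsymbol{\lambda}_1})^{r_1}(h^{(j)}_{\boldsymbol{\lambda}_2})^{r_2}\cdots$. The auxiliary umbra $\mu_1\boldsymbol{.}\beta\boldsymbol{.}\boldsymbol{\nu}_1+\cdots+\mu_n\boldsymbol{.}\beta\boldsymbol{.}\boldsymbol{\nu}_n$ ($\beta$ denotes the Bell umbra) is a symbolic $m$-tuple. Its moments are computed by first treating $\mu_1,\dots,\mu_n$ as constants (indeterminates), with the $n$ summands mutually uncorrelated and $$(\mu_j\boldsymbol{.}\beta\boldsymbol{.}\boldsymbol{\nu}_j)^{\boldsymbol{k}}\ \text{evaluated to}\ \sum_{\boldsymbol{\lambda}\vdash\boldsymbol{k}}\frac{\boldsymbol{k}!}{\mathfrak{m}(\boldsymbol{\lambda})!\,\boldsymbol{\lambda}!}\,\mu_j^{l(\boldsymbol{\lambda})}\,h^{(j)}_{\boldsymbol{\lambda}},$$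 and then applying $E$ to the resulting polynomial in $\mu_1,\dots,\mu_n$. Explicitly, for $\boldsymbol{i}\in\mathbb{N}_0^m$, the $\boldsymbol{i}$-th moment is $$\sum_{\boldsymbol{k}_1+\cdots+\boldsymbol{k}_n=\boldsymbol{i}}\frac{\boldsymbol{i}!}{\boldsymbol{k}_1!\cdots\boldsymbol{k}_n!}\sum_{\boldsymbol{\lambda}^{(1)}\vdash\boldsymbol{k}_1,\dots,\boldsymbol{\lambda}^{(n)}\vdash\boldsymbol{k}_n}\Big(\prod_{j=1}^n\frac{\boldsymbol{k}_j!}{\mathfrak{m}(\boldsymbol{\lambda}^{(j)})!\,\boldsymbol{\lambda}^{(j)}!}h^{(j)}_{\boldsymbol{\lambda}^{(j)}}\Big)E\big[\mu_1^{l(\boldsymbol{\lambda}^{(1)})}\cdots\mu_n^{l(\boldsymbol{\lambda}^{(n)})}\big].$$ Its generating function is the exponential generating function of these moments in $\boldsymbol{t}_{(m)}$. -}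

module Defs where

open import Level using (_⊔_)
open import Algebra.Bundles using (CommutativeRing; RawRing)
open import Algebra.Apartness.Bundles using (HeytingField; HeytingCommutativeRing)
open import Algebra.Module.Bundles using (RawLeftModule)
open import Algebra.Module.Construct.TensorUnit using (rawLeftModule)
open import Algebra.Module.Morphism.Structures using (module LeftModuleMorphisms)
import Algebra.Definitions.RawSemiring as RawSemiringDefs
open import Data.Bool.Base using (if_then_else_)
open import Data.Fin.Base using (Fin; zero; suc)
open import Data.List.Base as List using (List; []; _∷_; upTo; concatMap; cartesianProductWith; deduplicate; filter; foldr; length)
open import Data.List.Membership.Propositional using (_∈_)
open import Data.List.Membership.Propositional.Properties using (∈-filter⁺; ∈-filter⁻; ∈-concatMap⁺; ∈-map⁺; ∈-map⁻; ∈-upTo⁺; ∈-upTo⁻; ∈-cartesianProductWith⁺; ∈-cartesianProductWith⁻)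
open import Data.List.Relation.Unary.All as All using (All; []; _∷_)
import Data.List.Properties as List
import Data.List.Relation.Unary.All.Properties as All
open import Data.List.Relation.Unary.AllPairs as AllPairs using ([]; _∷_)
import Data.List.Relation.Unary.AllPairs.Properties as AllPairs
open import Data.List.Relation.Unary.Unique.Propositional using (Unique)
import Data.List.Relation.Unary.Unique.Propositional.Properties as Unique
open import Data.List.Relation.Unary.Any as Any using (here; there)
import Data.List.Relation.Unary.Sorted.TotalOrder as Sorted
open import Data.Nat.Base as ℕ using (ℕ; zero; suc; _!; NonZero; z≤n; s≤s)
import Data.Nat.ListAction as ℕ
import Data.Nat.ListAction.Properties as ℕ
import Data.Nat.Properties as ℕ
open import Algebra.Properties.CommutativeSemigroup ℕ.+-commutativeSemigroup using () renaming (interchange to ℕ-interchange)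
open import Data.Product.Base using (_,_; proj₁; proj₂)
open import Data.Vec.Base as Vec using (Vec; []; _∷_; lookup; toList; fromList)
open import Data.Vec.Functional using (Vector)
import Data.Vec.Properties as Vec
import Data.Vec.Relation.Binary.Lex.NonStrict as Lex
open import Function.Base using (_∘_; _$_)
open import Function.Definitions using (Injective)
open import Relation.Binary.Bundles using (DecTotalOrder)
open import Relation.Binary.PropositionalEquality.Core as ≡ using (_≡_; _≢_)
open import Relation.Binary.PropositionalEquality.Properties using (module ≡-Reasoning)
open import Relation.Nullary.Decidable using (Dec; yes; no; does; ¬?; _×-dec_; map′)
open import Relation.Nullary.Negation using (contradiction)

MultiIndex : ℕ → Set
MultiIndex m = Vec ℕ m

infix 4 _≟_
_≟_ : ∀ {m} (i j : MultiIndex m) → Dec (i ≡ j)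
_≟_ = Vec.≡-dec ℕ._≟_

𝟎 : ∀ {m} → MultiIndex m
𝟎 = Vec.replicate _ 0

infixl 6 _⊕_ _⊖_
_⊕_ _⊖_ : ∀ {m} → MultiIndex m → MultiIndex m → MultiIndex m
_⊕_ = Vec.zipWith ℕ._+_
_⊖_ = Vec.zipWith ℕ._∸_

∣_∣ : ∀ {m} → MultiIndex m → ℕ
∣_∣ = Vec.sum

infix 9 _!ᵐ
_!ᵐ : ∀ {m} → MultiIndex m → ℕ
i !ᵐ = ℕ.product (List.map _! (toList i))

product-map≢0 : ∀ {a} {B : Set a} (f : B → ℕ) → (∀ x → NonZero (f x)) →
                ∀ xs → NonZero (ℕ.product (List.map f xs))
product-map≢0 f f≢0 xs = ℕ.product≢0 (All.map⁺ (All.universal f≢0 xs))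

_!ᵐ≢0 : ∀ {m} (i : MultiIndex m) → NonZero (i !ᵐ)
i !ᵐ≢0 = product-map≢0 _! ℕ._!≢0 (toList i)

-- The cartesian product of n lists, as a list of n-tuples.
choices : ∀ {a} {B : Set a} {n} → Vec (List B) n → List (Vec B n)
choices []         = List.[ [] ]
choices (xs ∷ xss) = cartesianProductWith _∷_ xs (choices xss)

-- All j with j ≤ i componentwise.
below : ∀ {m} → MultiIndex m → List (MultiIndex m)
below i = choices (Vec.map (upTo ∘ suc) i)

-- All a ∈ ℕⁿ with ∣ a ∣ ≤ d.
degree≤ : ∀ n → ℕ → List (MultiIndex n)
degree≤ zero    d = List.[ [] ]
degree≤ (suc n) d = concatMap (λ a → List.map (a ∷_) (degree≤ n (d ℕ.∸ a))) (upTo (suc d))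

-- All (k₁ , … , kₙ) with k₁ ⊕ … ⊕ kₙ ≡ i.
decompositions : ∀ {m} n → MultiIndex m → List (Vec (MultiIndex m) n)
decompositions zero    i = if does (i ≟ 𝟎) then List.[ [] ] else []
decompositions (suc n) i = concatMap (λ k → List.map (k ∷_) (decompositions n (i ⊖ k))) (below i)

lexicographic : ℕ → DecTotalOrder _ _ _
lexicographic = Lex.≤-decTotalOrder ℕ.≤-decTotalOrder

-- A matrix with m rows is given by the list of its columns, which appear in
-- increasing (not necessarily strictly) lexicographic order.
record IsPartition {m} (i : MultiIndex m) (λs : List (MultiIndex m)) : Set where
  constructor isPartition
  field
    columns≢𝟎 : All (_≢ 𝟎) λs
    sorted    : Sorted.Sorted (DecTotalOrder.totalOrder (lexicographic m)) λs
    row-sums  : foldr _⊕_ 𝟎 λs ≡ i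

isPartition? : ∀ {m} (i : MultiIndex m) λs → Dec (IsPartition i λs)
isPartition? {m} i λs = map′ (λ (p , q , r) → isPartition p q r) (λ (isPartition p q r) → p , q , r)
  (All.all? (¬? ∘ (_≟ 𝟎)) λs ×-dec Sorted.sorted? totalOrder _≤?_ λs ×-dec foldr _⊕_ 𝟎 λs ≟ i)
  where open DecTotalOrder (lexicographic m) using (totalOrder; _≤?_)

-- A partition of i has at most ∣ i ∣ columns, since each of them is nonzero.
partitions : ∀ {m} → MultiIndex m → List (List (MultiIndex m))
partitions i = filter (isPartition? i) $
  concatMap (λ l → List.map toList (decompositions l i)) (upTo (suc ∣ i ∣))

multiplicity : ∀ {m} → MultiIndex m → List (MultiIndex m) → ℕ
multiplicity c = length ∘ filter (c ≟_)

-- The enumerations are complete and without repetition.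

∈-below : ∀ {m} (i : MultiIndex m) {j} → j ∈ below i → ∣ j ∣ ℕ.+ ∣ i ⊖ j ∣ ≡ ∣ i ∣
∈-below []      {[]} _ = ≡.refl
∈-below (x ∷ i) j∈
  with y , j , y∈ , j∈ , ≡.refl ← ∈-cartesianProductWith⁻ _∷_ (upTo (suc x)) (below i) j∈ = begin
    (y ℕ.+ ∣ j ∣) ℕ.+ (x ℕ.∸ y ℕ.+ ∣ i ⊖ j ∣) ≡⟨ ℕ-interchange y (∣ j ∣) (x ℕ.∸ y) (∣ i ⊖ j ∣) ⟩
    (y ℕ.+ (x ℕ.∸ y)) ℕ.+ (∣ j ∣ ℕ.+ ∣ i ⊖ j ∣) ≡⟨ ≡.cong₂ ℕ._+_ (ℕ.m+[n∸m]≡n (ℕ.s≤s⁻¹ (∈-upTo⁻ y∈))) (∈-below i j∈) ⟩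
    x ℕ.+ ∣ i ∣ ∎
  where open ≡-Reasoning

below-complete : ∀ {m} (j k : MultiIndex m) → j ∈ below (j ⊕ k)
below-complete []      []      = here ≡.refl
below-complete (x ∷ j) (y ∷ k) =
  ∈-cartesianProductWith⁺ _∷_ (∈-upTo⁺ (s≤s (ℕ.m≤m+n x y))) (below-complete j k)

⊕-⊖ : ∀ {m} (j k : MultiIndex m) → (j ⊕ k) ⊖ j ≡ k
⊕-⊖ []      []      = ≡.refl
⊕-⊖ (x ∷ j) (y ∷ k) = ≡.cong₂ _∷_ (ℕ.m+n∸m≡n x y) (⊕-⊖ j k)

below-unique : ∀ {m} (i : MultiIndex m) → Unique (below i)
below-unique []      = [] ∷ []
below-unique (x ∷ i) = Unique.cartesianProductWith⁺ _∷_ Vec.∷-injective (Unique.upTo⁺ (suc x)) (below-unique i)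

concatMap-unique : ∀ {b d} {B : Set b} {D : Set d} (g : B → List D) {xs} →
                   (∀ {x y z} → z ∈ g x → z ∈ g y → x ≡ y) →
                   (∀ x → Unique (g x)) → Unique xs → Unique (concatMap g xs)
concatMap-unique g disjoint g! xs! = Unique.concat⁺
  (All.map⁺ (All.universal g! _))
  (AllPairs.map⁺ (AllPairs.map (λ x≢y {_} (z∈ , z∈′) → x≢y (disjoint z∈ z∈′)) xs!))

decompositions-complete : ∀ {m} {i : MultiIndex m} λs → foldr _⊕_ 𝟎 λs ≡ i →
                          fromList λs ∈ decompositions (length λs) i
decompositions-complete {i = i} [] 𝟎≡i with i ≟ 𝟎
... | yes _  = here ≡.refl
... | no i≢𝟎 = contradiction (≡.sym 𝟎≡i) i≢𝟎
decompositions-complete (k ∷ λs) ≡.refl =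
  ∈-concatMap⁺ _ (Any.map (λ { ≡.refl → ∈-map⁺ (k ∷_) (decompositions-complete λs (≡.sym (⊕-⊖ k _))) })
    (below-complete k (foldr _⊕_ 𝟎 λs)))

∷-heads : ∀ {b} {B : Set b} {n x y} {z : Vec B (suc n)} {xs ys} →
          z ∈ List.map (x ∷_) xs → z ∈ List.map (y ∷_) ys → x ≡ y
∷-heads z∈ z∈′ with _ , _ , p ← ∈-map⁻ _ z∈ | _ , _ , q ← ∈-map⁻ _ z∈′ =
  Vec.∷-injectiveˡ (≡.trans (≡.sym p) q)

decompositions-unique : ∀ {m} n (i : MultiIndex m) → Unique (decompositions n i)
decompositions-unique zero    i with i ≟ 𝟎
... | yes _ = [] ∷ []
... | no  _ = []
decompositions-unique (suc n) i = concatMap-unique _ ∷-heads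
  (λ k → Unique.map⁺ Vec.∷-injectiveʳ (decompositions-unique n (i ⊖ k))) (below-unique i)

degree≤-complete : ∀ {n d} (a : MultiIndex n) → ∣ a ∣ ℕ.≤ d → a ∈ degree≤ n d
degree≤-complete []      _   = here ≡.refl
degree≤-complete (x ∷ a) a≤d =
  ∈-concatMap⁺ _ (Any.map (λ { ≡.refl → ∈-map⁺ (x ∷_) (degree≤-complete a (ℕ.m+n≤o⇒m≤o∸n _ (ℕ.≤-trans (ℕ.≤-reflexive (ℕ.+-comm _ x)) a≤d))) })
    (∈-upTo⁺ (s≤s (ℕ.m+n≤o⇒m≤o x a≤d))))

degree≤-unique : ∀ n d → Unique (degree≤ n d)
degree≤-unique zero    d = [] ∷ []
degree≤-unique (suc n) d = concatMap-unique _ ∷-heads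
  (λ a → Unique.map⁺ Vec.∷-injectiveʳ (degree≤-unique n (d ℕ.∸ a))) (Unique.upTo⁺ (suc d))

∣⊕∣ : ∀ {m} (j k : MultiIndex m) → ∣ j ⊕ k ∣ ≡ ∣ j ∣ ℕ.+ ∣ k ∣
∣⊕∣ []      []      = ≡.refl
∣⊕∣ (x ∷ j) (y ∷ k) = ≡.trans (≡.cong (x ℕ.+ y ℕ.+_) (∣⊕∣ j k)) (ℕ-interchange x y (∣ j ∣) (∣ k ∣))

∣≢𝟎∣ : ∀ {m} {k : MultiIndex m} → k ≢ 𝟎 → 1 ℕ.≤ ∣ k ∣
∣≢𝟎∣ {k = []}        k≢𝟎 = contradiction ≡.refl k≢𝟎
∣≢𝟎∣ {k = zero ∷ k}  k≢𝟎 = ∣≢𝟎∣ (k≢𝟎 ∘ ≡.cong (0 ∷_))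
∣≢𝟎∣ {k = suc x ∷ k} k≢𝟎 = s≤s z≤n

length≤ : ∀ {m} {λs : List (MultiIndex m)} → All (_≢ 𝟎) λs → length λs ℕ.≤ ∣ foldr _⊕_ 𝟎 λs ∣
length≤ []           = z≤n
length≤ {λs = k ∷ λs} (k≢𝟎 ∷ λs≢𝟎) = ℕ.≤-trans
  (ℕ.+-mono-≤ (∣≢𝟎∣ k≢𝟎) (length≤ λs≢𝟎)) (ℕ.≤-reflexive (≡.sym (∣⊕∣ k (foldr _⊕_ 𝟎 λs))))

partitions-sound : ∀ {m} (i : MultiIndex m) {λs} → λs ∈ partitions i → IsPartition i λs
partitions-sound i λs∈ = proj₂ (∈-filter⁻ (isPartition? i) {xs = concatMap (λ l → List.map toList (decompositions l i)) (upTo (suc ∣ i ∣))} λs∈)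

partitions-complete : ∀ {m} {i : MultiIndex m} {λs} → IsPartition i λs → λs ∈ partitions i
partitions-complete {i = i} {λs} λs⊢i@(isPartition λs≢𝟎 _ ≡.refl) =
  ∈-filter⁺ (isPartition? i) (∈-concatMap⁺ (λ l → List.map toList (decompositions l i)) (Any.map
    (λ { ≡.refl → ≡.subst (_∈ List.map toList (decompositions (length λs) i)) (Vec.toList∘fromList λs) (∈-map⁺ toList (decompositions-complete λs ≡.refl)) })
    (∈-upTo⁺ (s≤s (length≤ λs≢𝟎))))) λs⊢i

partitions-unique : ∀ {m} (i : MultiIndex m) → Unique (partitions i)
partitions-unique i = Unique.filter⁺ (isPartition? i) $ concatMap-unique _ lengths
  (λ l → Unique.map⁺ (λ {u} {v} → toList-injective u v) (decompositions-unique l i)) (Unique.upTo⁺ (suc ∣ i ∣))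
  where
  toList-injective : ∀ {b} {B : Set b} {n} (u v : Vec B n) → toList u ≡ toList v → u ≡ v
  toList-injective []      []       _ = ≡.refl
  toList-injective (x ∷ u) (y ∷ v) p = ≡.cong₂ _∷_ (List.∷-injectiveˡ p) (toList-injective u v (List.∷-injectiveʳ p))
  lengths : ∀ {l l′ z} → z ∈ List.map toList (decompositions l i) → z ∈ List.map toList (decompositions l′ i) → l ≡ l′
  lengths z∈ z∈′ with u , _ , p ← ∈-map⁻ _ z∈ | v , _ , q ← ∈-map⁻ _ z∈′ =
    ≡.trans (≡.sym (Vec.length-toList u))
      (≡.trans (≡.cong length (≡.trans (≡.sym p) q)) (Vec.length-toList v))

infix 9 𝔪_! _!ˡ
𝔪_! : ∀ {m} → List (MultiIndex m) → ℕ
𝔪 λs ! = ℕ.product (List.map (λ c → multiplicity c λs !) (deduplicate _≟_ λs))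

-- For a partition, the product of the factorials of all entries.
_!ˡ : ∀ {m} → List (MultiIndex m) → ℕ
λs !ˡ = ℕ.product (List.map _!ᵐ λs)

_!ˡ≢0 : ∀ {m} (λs : List (MultiIndex m)) → NonZero (λs !ˡ)
λs !ˡ≢0 = product-map≢0 _!ᵐ _!ᵐ≢0 λs

𝔪_!*!ˡ≢0 : ∀ {m} (λs : List (MultiIndex m)) → NonZero (𝔪 λs ! ℕ.* λs !ˡ)
𝔪 λs !*!ˡ≢0 = ℕ.m*n≢0 _ _
  {{product-map≢0 _ (λ c → multiplicity c λs ℕ.!≢0) (deduplicate _≟_ λs)}} {{λs !ˡ≢0}}

module FormalPowerSeries {c ℓ} (K : CommutativeRing c ℓ) where
  open CommutativeRing K hiding (zero)
  open RawSemiringDefs (RawRing.rawSemiring rawRing) using () renaming (product to ∏) public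

  ∑ : ∀ {b} {B : Set b} → List B → (B → Carrier) → Carrier
  ∑ xs f = foldr _+_ 0# (List.map f xs)

  infix 5 ∑
  syntax ∑ xs (λ x → e) = ∑[ x ← xs ] e

  -- A series is given by its coefficients.
  Series : ℕ → Set c
  Series m = MultiIndex m → Carrier

  seriesRing : ℕ → RawRing c ℓ
  seriesRing m = record
    { Carrier = Series m
    ; _≈_     = λ s t → ∀ i → s i ≈ t i
    ; _+_     = λ s t i → s i + t i
    ; _*_     = λ s t i → ∑[ j ← below i ] s j * t (i ⊖ j)
    ; -_      = λ s i → - s i
    ; 0#      = λ i → 0#
    ; 1#      = λ i → if does (i ≟ 𝟎) then 1# else 0#
    }

  module _ {m : ℕ} where
    open RawRing (seriesRing m) public using ()
      renaming (_≈_ to infix 4 _≈ˢ_; _+_ to _+ˢ_; _*_ to _*ˢ_; -_ to -ˢ_; 0# to 0ˢ; 1# to 1ˢ)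
    open RawSemiringDefs (RawRing.rawSemiring (seriesRing m)) public using ()
      renaming (_^_ to _^ˢ_; product to ∏ˢ)

  _^ᵐ_ : ∀ {m n} → Vector (Series m) n → MultiIndex n → Series m
  s ^ᵐ a = ∏ˢ (λ j → s j ^ˢ lookup a j)

  WithoutConstantTerm : ∀ {m} → Series m → Set ℓ
  WithoutConstantTerm s = s 𝟎 ≈ 0#

  -- The coefficient of tⁱ in Σₐ fₐ sᵃ.  The terms with ∣ a ∣ > ∣ i ∣ do not
  -- contribute, see ^ᵐ-vanishes below.
  substitute : ∀ {m n} → Series n → (s : Vector (Series m) n) →
               (∀ j → WithoutConstantTerm (s j)) → Series m
  substitute {n = n} f s _ i = ∑[ a ← degree≤ n ∣ i ∣ ] f a * (s ^ᵐ a) i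

  Order≥ : ∀ {m} → ℕ → Series m → Set ℓ
  Order≥ d s = ∀ i → ∣ i ∣ ℕ.< d → s i ≈ 0#

  ∑-zero : ∀ {b} {B : Set b} (xs : List B) (g : B → Carrier) → (∀ {x} → x ∈ xs → g x ≈ 0#) → (∑[ x ← xs ] g x) ≈ 0#
  ∑-zero []       g g≈0 = refl
  ∑-zero (x ∷ xs) g g≈0 = trans (+-cong (g≈0 (here ≡.refl)) (∑-zero xs g (g≈0 ∘ there))) (+-identityˡ 0#)

  withoutConstantTerm⇒Order≥1 : ∀ {m} (s : Series m) → WithoutConstantTerm s → Order≥ 1 s
  withoutConstantTerm⇒Order≥1 s s₀ i i<1 with i ≟ 𝟎
  ... | yes ≡.refl = s₀
  ... | no i≢𝟎     = contradiction (∣≢𝟎∣ i≢𝟎) (ℕ.<⇒≱ i<1)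

  Order≥-* : ∀ {m} d e (s t : Series m) → Order≥ d s → Order≥ e t → Order≥ (d ℕ.+ e) (s *ˢ t)
  Order≥-* d e s t s≥ t≥ i i<d+e = ∑-zero (below i) (λ j → s j * t (i ⊖ j)) vanish
    where
    vanish : ∀ {j} → j ∈ below i → s j * t (i ⊖ j) ≈ 0#
    vanish {j} j∈ with ∣ j ∣ ℕ.<? d
    ... | yes j<d = trans (*-congʳ (s≥ j j<d)) (zeroˡ _)
    ... | no  j≮d with ∣ i ⊖ j ∣ ℕ.<? e
    ...   | yes k<e = trans (*-congˡ (t≥ _ k<e)) (zeroʳ _)
    ...   | no  k≮e = contradiction
              (ℕ.≤-trans (ℕ.+-mono-≤ (ℕ.≮⇒≥ j≮d) (ℕ.≮⇒≥ k≮e)) (ℕ.≤-reflexive (∈-below i j∈)))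
              (ℕ.<⇒≱ i<d+e)

  Order≥-^ : ∀ {m} (s : Series m) → WithoutConstantTerm s → ∀ p → Order≥ p (s ^ˢ p)
  Order≥-^ s s₀ zero    _ ()
  Order≥-^ s s₀ (suc p) = Order≥-* 1 p s (s ^ˢ p) (withoutConstantTerm⇒Order≥1 s s₀) (Order≥-^ s s₀ p)

  ^ᵐ-vanishes : ∀ {m n} (s : Vector (Series m) n) → (∀ j → WithoutConstantTerm (s j)) →
                ∀ a i → ∣ i ∣ ℕ.< ∣ a ∣ → (s ^ᵐ a) i ≈ 0#
  ^ᵐ-vanishes s s₀ []      _ ()
  ^ᵐ-vanishes s s₀ (p ∷ a) = Order≥-* p (∣ a ∣) (s zero ^ˢ p) ((s ∘ suc) ^ᵐ a)
    (Order≥-^ (s zero) (s₀ zero) p) (^ᵐ-vanishes (s ∘ suc) (s₀ ∘ suc) a)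

CharacteristicZero : ∀ {c ℓ₁ ℓ₂} → HeytingField c ℓ₁ ℓ₂ → Set ℓ₂
CharacteristicZero F = ∀ n → .{{NonZero n}} → n ×# 1# # 0#
  where
  open HeytingField F
  open CommutativeRing (HeytingCommutativeRing.commutativeRing heytingCommutativeRing) using (rawRing)
  open RawSemiringDefs (RawRing.rawSemiring rawRing) using () renaming (_×_ to _×#_)

-- The free commutative K-algebra on A.
module Polynomials {c ℓ a} (K : CommutativeRing c ℓ) (A : Set a) where
  open CommutativeRing K hiding (zero)

  infixl 6 _+ᴾ_
  infixl 7 _*ᴾ_
  infix  8 -ᴾ_
  infix  4 _≈ᴾ_

  data Polynomial : Set (c ⊔ a) where
    con       : Carrier → Polynomial
    umbra     : A → Polynomial
    _+ᴾ_ _*ᴾ_ : Polynomial → Polynomial → Polynomial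
    -ᴾ_       : Polynomial → Polynomial

  data _≈ᴾ_ : Polynomial → Polynomial → Set (c ⊔ ℓ ⊔ a) where
    reflᴾ       : ∀ {p} → p ≈ᴾ p
    symᴾ        : ∀ {p q} → p ≈ᴾ q → q ≈ᴾ p
    transᴾ      : ∀ {p q r} → p ≈ᴾ q → q ≈ᴾ r → p ≈ᴾ r
    con-cong    : ∀ {x y} → x ≈ y → con x ≈ᴾ con y
    con-homo-+  : ∀ x y → con (x + y) ≈ᴾ con x +ᴾ con y
    con-homo-*  : ∀ x y → con (x * y) ≈ᴾ con x *ᴾ con y
    +-congᴾ     : ∀ {p p′ q q′} → p ≈ᴾ p′ → q ≈ᴾ q′ → p +ᴾ q ≈ᴾ p′ +ᴾ q′
    *-congᴾ     : ∀ {p p′ q q′} → p ≈ᴾ p′ → q ≈ᴾ q′ → p *ᴾ q ≈ᴾ p′ *ᴾ q′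
    -‿congᴾ     : ∀ {p p′} → p ≈ᴾ p′ → -ᴾ p ≈ᴾ -ᴾ p′
    +-assocᴾ    : ∀ p q r → (p +ᴾ q) +ᴾ r ≈ᴾ p +ᴾ (q +ᴾ r)
    +-commᴾ     : ∀ p q → p +ᴾ q ≈ᴾ q +ᴾ p
    +-identityᴾ : ∀ p → con 0# +ᴾ p ≈ᴾ p
    -‿inverseᴾ  : ∀ p → -ᴾ p +ᴾ p ≈ᴾ con 0#
    *-assocᴾ    : ∀ p q r → (p *ᴾ q) *ᴾ r ≈ᴾ p *ᴾ (q *ᴾ r)
    *-commᴾ     : ∀ p q → p *ᴾ q ≈ᴾ q *ᴾ p
    *-identityᴾ : ∀ p → con 1# *ᴾ p ≈ᴾ p
    distribᴾ    : ∀ p q r → p *ᴾ (q +ᴾ r) ≈ᴾ p *ᴾ q +ᴾ p *ᴾ r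

  polynomialRing : CommutativeRing (c ⊔ a) (c ⊔ ℓ ⊔ a)
  polynomialRing = record
    { _≈_ = _≈ᴾ_ ; _+_ = _+ᴾ_ ; _*_ = _*ᴾ_ ; -_ = -ᴾ_ ; 0# = con 0# ; 1# = con 1#
    ; isCommutativeRing = record
      { isRing = record
        { +-isAbelianGroup = record
          { isGroup = record
            { isMonoid = record
              { isSemigroup = record
                { isMagma = record
                  { isEquivalence = record { refl = reflᴾ ; sym = symᴾ ; trans = transᴾ }
                  ; ∙-cong = +-congᴾ
                  }
                ; assoc = +-assocᴾ
                }
              ; identity = +-identityᴾ , λ p → transᴾ (+-commᴾ p _) (+-identityᴾ p)
              }
            ; inverse = -‿inverseᴾ , λ p → transᴾ (+-commᴾ p _) (-‿inverseᴾ p)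
            ; ⁻¹-cong = -‿congᴾ
            }
          ; comm = +-commᴾ
          }
        ; *-cong = *-congᴾ
        ; *-assoc = *-assocᴾ
        ; *-identity = *-identityᴾ , λ p → transᴾ (*-commᴾ p _) (*-identityᴾ p)
        ; distrib = distribᴾ , λ p q r →
            transᴾ (*-commᴾ _ p) (transᴾ (distribᴾ p q r) (+-congᴾ (*-commᴾ p q) (*-commᴾ p r)))
        }
      ; *-comm = *-commᴾ
      }
    }

  open RawSemiringDefs (RawRing.rawSemiring (CommutativeRing.rawRing polynomialRing)) public using ()
    renaming (_^_ to _^ᴾ_; product to ∏ᴾ)

  polynomialModule : RawLeftModule Carrier (c ⊔ a) (c ⊔ ℓ ⊔ a)
  polynomialModule = record
    { _≈ᴹ_ = _≈ᴾ_ ; _+ᴹ_ = _+ᴾ_ ; _*ₗ_ = λ x p → con x *ᴾ p ; 0ᴹ = con 0# ; -ᴹ_ = -ᴾ_ }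

  record Evaluation : Set (c ⊔ ℓ ⊔ a) where
    open LeftModuleMorphisms polynomialModule (rawLeftModule {R = rawRing})
    open RawSemiringDefs (RawRing.rawSemiring rawRing) using () renaming (product to ∏)
    field
      E            : Polynomial → Carrier
      linear       : IsLeftModuleHomomorphism E
      normalized   : E (con 1#) ≈ 1#
      uncorrelated : ∀ {k} (α : Vector A k) → Injective _≡_ _≡_ α → (e : Vector ℕ k) →
                     E (∏ᴾ (λ j → umbra (α j) ^ᴾ e j)) ≈ ∏ (λ j → E (umbra (α j) ^ᴾ e j))

  -- A scalar times a product of not necessarily distinct umbrae; the pure power
  -- products are those with coefficient 1#.
  record Monomial : Set (c ⊔ a) where
    constructor _∙_
    field
      coefficient : Carrier
      umbrae      : List A

    toPolynomial : Polynomial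
    toPolynomial = con coefficient *ᴾ foldr (λ α p → umbra α *ᴾ p) (con 1#) umbrae

-- R stands for the real or complex field; it enters only as a field of
-- characteristic zero.
module UmbralCalculus {c ℓ₁ ℓ₂ a} (R : HeytingField c ℓ₁ ℓ₂) (char0 : CharacteristicZero R) (A : Set a) where
  open HeytingField R
  open HeytingCommutativeRing heytingCommutativeRing using (commutativeRing) public
  open CommutativeRing commutativeRing using (rawRing)
  open RawSemiringDefs (RawRing.rawSemiring rawRing) using () renaming (_×_ to _×#_)
  open FormalPowerSeries commutativeRing public
  open Polynomials commutativeRing A public

  infixl 7 _/_
  _/_ : ℕ → (d : ℕ) .{{_ : NonZero d}} → Carrier
  p / d = (p ×# 1#) * proj₁ (#⇒invertible (char0 d))

  module _ (evaluation : Evaluation) where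
    open Evaluation evaluation

    moment : ∀ {k} → Vector Monomial k → MultiIndex k → Carrier
    moment μ i = E (∏ᴾ (λ j → Monomial.toPolynomial (μ j) ^ᴾ lookup i j))

    genFun : ∀ {k} → Vector Monomial k → Series k
    genFun μ i = if does (i ≟ 𝟎) then 1# else moment μ i * (1 / i !ᵐ) {{i !ᵐ≢0}}

    genFun-1 : ∀ {k} → Vector Monomial k → Series k
    genFun-1 μ = genFun μ +ˢ -ˢ 1ˢ

    genFun-1-withoutConstantTerm : ∀ {k} (μ : Vector Monomial k) → WithoutConstantTerm (genFun-1 μ)
    genFun-1-withoutConstantTerm {k} μ with 𝟎 {k} ≟ 𝟎
    ... | yes _  = -‿inverseʳ 1#
    ... | no 𝟎≢𝟎 = contradiction ≡.refl 𝟎≢𝟎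

    -- h_λ for hₖ = E[νᵏ]: the product over the columns, with multiplicity.
    partitionMoment : ∀ {m} → Vector Monomial m → List (MultiIndex m) → Carrier
    partitionMoment ν = foldr (λ k x → moment ν k * x) 1#

    module _ {m n} (μ : Vector Monomial n) (ν : Fin n → Vector Monomial m) where

      -- The i-th moment of μ₁.β.ν₁ + ⋯ + μₙ.β.νₙ.
      auxMoment : MultiIndex m → Carrier
      auxMoment i =
        ∑[ ks ← decompositions n i ]
          (i !ᵐ / toList ks !ˡ) {{toList ks !ˡ≢0}} *
          (∑[ λs ← choices (Vec.map partitions ks) ]
            ∏ (λ j → weight (lookup ks j) (lookup λs j) * partitionMoment (ν j) (lookup λs j)) *
            moment μ (Vec.map length λs))
        where
        weight : MultiIndex m → List (MultiIndex m) → Carrier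
        weight k κ = (k !ᵐ / (𝔪 κ ! ℕ.* κ !ˡ)) {{𝔪 κ !*!ˡ≢0}}

      auxGenFun : Series m
      auxGenFun i = auxMoment i * (1 / i !ᵐ) {{i !ᵐ≢0}}

{-# OPTIONS --safe #-}
module Submission where

-- With w(λ) = h_λ / (𝔪(λ)! λ!) and s = f(ν , t) - 1, everything rests on
--   sˡ = l! Σ_k tᵏ Σ { w(λ) ∣ λ ⊢ k with l columns },
-- proved by induction on l.  Write l + 1 as the sum over all columns c of the
-- multiplicity of c in λ.  For fixed c, inserting c is a bijection from the
-- partitions of k - c onto the partitions of k in which c occurs, and if c
-- occurs r times in λ then (r + 1) w(c ∷ λ) = s_c w(λ): this is the product s sˡ.
-- Expanding f(μ , s₁ , … , sₙ) by these formulas, the exponent a = (a₁ , … , aₙ)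
-- is forced to be the vector of lengths of (λ⁽¹⁾ , … , λ⁽ⁿ⁾), and what remains is
-- the explicit formula for the moments of the auxiliary umbra.

open import Algebra.Apartness.Bundles using (HeytingField; HeytingCommutativeRing)
open import Algebra.Bundles using (CommutativeRing)
open import Algebra.Module.Morphism.Structures using (module LeftModuleMorphisms)
import Algebra.Properties.CommutativeMonoid.Sum as CommutativeMonoidSum
import Algebra.Properties.CommutativeSemigroup as CommutativeSemigroupProperties
import Algebra.Properties.Ring as RingProperties
import Algebra.Properties.Semiring.Mult as SemiringMult
import Algebra.Solver.CommutativeMonoid as CommutativeMonoidSolver
open import Algebra.Structures using (IsCommutativeMonoid)
open import Data.Bool.Base using (if_then_else_; true; false)
open import Data.Fin.Base using (Fin; zero; suc)
open import Data.List.Base using (List; []; _∷_; _++_; map; filter; deduplicate; foldr; length; upTo; concatMap; cartesianProductWith)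
import Data.List.Membership.DecPropositional as DecMembership
open import Data.List.Membership.Propositional using (_∈_; _∉_; find)
open import Data.List.Membership.Propositional.Properties using (∈-filter⁺; ∈-filter⁻; ∈-map⁺; ∈-map⁻; ∈-∃++; ∈-cartesianProductWith⁻; ∈-concatMap⁻; ∈-deduplicate⁺; ∈-deduplicate⁻; ∈-upTo⁻)
open import Data.List.Membership.Propositional.Properties.WithK using (unique∧set⇒bag)
import Data.List.Properties as List
open import Data.List.Relation.Binary.BagAndSetEquality using (∼bag⇒↭)
import Data.List.Relation.Binary.Permutation.Homogeneous as Homogeneous
open import Data.List.Relation.Binary.Permutation.Propositional as ↭ using (_↭_; ↭-sym; ↭-trans; prep; ↭⇒↭ₛ)
import Data.List.Relation.Binary.Permutation.Propositional.Properties as ↭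
import Data.List.Relation.Binary.Permutation.Setoid.Properties as ↭ₛ
import Data.List.Relation.Binary.Pointwise as Pointwise
open import Data.List.Relation.Unary.All as All using (All; []; _∷_)
import Data.List.Relation.Unary.All.Properties as All
open import Data.List.Relation.Unary.AllPairs using ([]; _∷_)
open import Data.List.Relation.Unary.Any using (here; there)
import Data.List.Relation.Unary.Linked as Linked
import Data.List.Relation.Unary.Sorted.TotalOrder as Sorted
import Data.List.Relation.Unary.Sorted.TotalOrder.Properties as Sorted
import Data.List.Relation.Unary.Unique.DecPropositional.Properties as UniqueDec
open import Data.List.Relation.Unary.Unique.Propositional using (Unique)
import Data.List.Relation.Unary.Unique.Propositional.Properties as Unique
import Data.List.Sort as Sort
open import Data.Nat.Base as ℕ using (ℕ; zero; suc; _!; NonZero)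
import Data.Nat.ListAction as ℕ
import Data.Nat.ListAction.Properties as ℕ
import Data.Nat.Properties as ℕ
open import Data.Product.Base using (_,_; proj₁; proj₂)
open import Data.Vec.Base as Vec using (Vec; []; _∷_; lookup; toList)
open import Data.Vec.Functional using (Vector)
import Data.Vec.Properties as Vec
import Data.Vec.Relation.Binary.Pointwise.Inductive as VecPointwise
open import Function.Base using (_∘_)
open import Function.Bundles using (mk⇔)
open import Relation.Binary.Bundles using (DecTotalOrder)
open import Relation.Binary.Definitions using (DecidableEquality)
open import Relation.Binary.PropositionalEquality.Core as ≡ using (_≡_; _≢_)
import Relation.Binary.PropositionalEquality.Properties as ≡
import Relation.Binary.Reasoning.Setoid as SetoidReasoning
open import Relation.Nullary.Decidable using (Dec; yes; no; does; ¬?)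
open import Relation.Nullary.Negation using (¬_; contradiction)
open import Relation.Unary using (Decidable)
open import Defs

-- Repetition-free lists up to permutation.

module _ {b} {B : Set b} where

  unique∧set⇒↭ : {xs ys : List B} → Unique xs → Unique ys →
                 (∀ {x} → x ∈ xs → x ∈ ys) → (∀ {x} → x ∈ ys → x ∈ xs) → xs ↭ ys
  unique∧set⇒↭ xs! ys! xs⊆ys ys⊆xs = ∼bag⇒↭ (unique∧set⇒bag xs! ys! (mk⇔ xs⊆ys ys⊆xs))

  -- Injectivity is asked on the members of `xs` only: `adjoinColumn c` forgets the order of its
  -- argument, so in general it is injective on sorted lists only.
  map-unique : ∀ {d} {D : Set d} (f : B → D) {xs} →
               (∀ {x y} → x ∈ xs → y ∈ xs → f x ≡ f y → x ≡ y) → Unique xs → Unique (map f xs)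
  map-unique f inj []         = []
  map-unique f inj (x∉ ∷ xs!) =
    All.map⁺ (All.tabulate λ y∈ fx≡fy → All.lookup x∉ y∈ (inj (here ≡.refl) (there y∈) fx≡fy)) ∷
    map-unique f (λ x∈ y∈ → inj (there x∈) (there y∈)) xs!

-- Lists of columns up to permutation, their multiplicities and factorials.

module _ {m : ℕ} where

  ⊕-isCommutativeMonoid : IsCommutativeMonoid _≡_ (_⊕_ {m}) 𝟎
  ⊕-isCommutativeMonoid = record
    { isMonoid = record
      { isSemigroup = record
        { isMagma = record { isEquivalence = ≡.isEquivalence ; ∙-cong = ≡.cong₂ _⊕_ }
        ; assoc = Vec.zipWith-assoc ℕ.+-assoc
        }
      ; identity = Vec.zipWith-identityˡ ℕ.+-identityˡ , Vec.zipWith-identityʳ ℕ.+-identityʳ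
      }
    ; comm = Vec.zipWith-comm ℕ.+-comm
    }

  foldr-⊕-↭ : {λs κs : List (MultiIndex m)} → λs ↭ κs → foldr _⊕_ 𝟎 λs ≡ foldr _⊕_ 𝟎 κs
  foldr-⊕-↭ p = ↭ₛ.foldr-commMonoid (≡.setoid _) ⊕-isCommutativeMonoid (↭⇒↭ₛ p)

  !ˡ-↭ : {λs κs : List (MultiIndex m)} → λs ↭ κs → λs !ˡ ≡ κs !ˡ
  !ˡ-↭ p = ℕ.product-↭ (↭.map⁺ _!ᵐ p)

  multiplicity-↭ : ∀ c {λs κs : List (MultiIndex m)} → λs ↭ κs → multiplicity c λs ≡ multiplicity c κs
  multiplicity-↭ c p = ↭.↭-length (↭.filter-↭ (c ≟_) p)

  multiplicity-∷-≡ : ∀ (c : MultiIndex m) λs → multiplicity c (c ∷ λs) ≡ suc (multiplicity c λs)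
  multiplicity-∷-≡ c λs = ≡.cong length (List.filter-accept (c ≟_) {xs = λs} ≡.refl)

  multiplicity-∷-≢ : ∀ {c d : MultiIndex m} λs → d ≢ c → multiplicity d (c ∷ λs) ≡ multiplicity d λs
  multiplicity-∷-≢ {d = d} λs d≢c = ≡.cong length (List.filter-reject (d ≟_) {xs = λs} d≢c)

  ∉⇒multiplicity≡0 : ∀ {c : MultiIndex m} {λs} → c ∉ λs → multiplicity c λs ≡ 0
  ∉⇒multiplicity≡0 {c} c∉ = ≡.cong length (List.filter-none (c ≟_) (All.tabulate λ { d∈ ≡.refl → c∉ d∈ }))

  open UniqueDec (_≟_ {m}) using (deduplicate-!)
  open DecMembership (_≟_ {m}) using (_∈?_) public

  -- The two deduplicated lists may come in different orders, but they have no repetitions and the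
  -- same members, so they are permutations of each other.
  𝔪-↭ : {λs κs : List (MultiIndex m)} → λs ↭ κs → 𝔪 λs ! ≡ 𝔪 κs !
  𝔪-↭ {λs} {κs} p = ≡.trans
    (≡.cong ℕ.product (List.map-cong (λ c → ≡.cong _! (multiplicity-↭ c p)) (deduplicate _≟_ λs)))
    (ℕ.product-↭ (↭.map⁺ (λ c → multiplicity c κs !) (unique∧set⇒↭ (deduplicate-! λs) (deduplicate-! κs)
      (∈-deduplicate⁺ _≟_ ∘ ↭.∈-resp-↭ p ∘ ∈-deduplicate⁻ _≟_ λs)
      (∈-deduplicate⁺ _≟_ ∘ ↭.∈-resp-↭ (↭-sym p) ∘ ∈-deduplicate⁻ _≟_ κs))))

  -- If `c` is absent from `D`, the extracted factor must be 1. This is the case `0 ! ≡ 1` when `f`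
  -- is the factorial of a multiplicity.
  product-extract : (f : MultiIndex m → ℕ) (c : MultiIndex m) {D : List (MultiIndex m)} → Unique D → (c ∉ D → f c ≡ 1) →
                    ℕ.product (map f D) ≡ f c ℕ.* ℕ.product (map f (filter (¬? ∘ (c ≟_)) D))
  product-extract f c {D} D! fc≡1 with c ∈? D
  ... | no c∉D = ≡.sym (≡.trans
    (≡.cong₂ (λ x xs → x ℕ.* ℕ.product (map f xs)) (fc≡1 c∉D)
      (List.filter-all (¬? ∘ (c ≟_)) (All.tabulate λ { d∈ ≡.refl → c∉D d∈ })))
    (ℕ.*-identityˡ _))
  ... | yes c∈D = ℕ.product-↭ (↭.map⁺ f (unique∧set⇒↭ D! (All.all-filter (¬? ∘ (c ≟_)) D ∷ Unique.filter⁺ (¬? ∘ (c ≟_)) D!) to from))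
    where
    to : ∀ {d} → d ∈ D → d ∈ c ∷ filter (¬? ∘ (c ≟_)) D
    to {d} d∈ with c ≟ d
    ... | yes ≡.refl = here ≡.refl
    ... | no c≢d     = there (∈-filter⁺ (¬? ∘ (c ≟_)) d∈ c≢d)
    from : ∀ {d} → d ∈ c ∷ filter (¬? ∘ (c ≟_)) D → d ∈ D
    from (here ≡.refl) = c∈D
    from (there d∈)    = proj₁ (∈-filter⁻ (¬? ∘ (c ≟_)) d∈)

  -- Only the multiplicity of `c` changes, from `r` to `suc r`, and `suc r !` is `suc r ℕ.* r !`.
  𝔪-∷ : ∀ (c : MultiIndex m) λs → 𝔪 c ∷ λs ! ≡ suc (multiplicity c λs) ℕ.* 𝔪 λs !
  𝔪-∷ c λs = begin
    -- By computation, `deduplicate` keeps the leading `c` and filters it out of the deduplicated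
    -- tail `D`.
    multiplicity c (c ∷ λs) ! ℕ.* ℕ.product (map (λ d → multiplicity d (c ∷ λs) !) D∖c)
      ≡⟨ ≡.cong₂ (λ r xs → r ! ℕ.* ℕ.product xs) (multiplicity-∷-≡ c λs)
           (List.map-cong-local (All.map (λ c≢d → ≡.cong _! (multiplicity-∷-≢ λs (c≢d ∘ ≡.sym))) (All.all-filter (¬? ∘ (c ≟_)) D))) ⟩
    suc r ℕ.* r ! ℕ.* ℕ.product (map f D∖c)
      ≡⟨ ℕ.*-assoc (suc r) (r !) _ ⟩
    suc r ℕ.* (r ! ℕ.* ℕ.product (map f D∖c))
      ≡⟨ ≡.cong (suc r ℕ.*_) (product-extract f c (deduplicate-! λs) (λ c∉D → ≡.cong _! (∉⇒multiplicity≡0 (c∉D ∘ ∈-deduplicate⁺ _≟_)))) ⟨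
    suc r ℕ.* 𝔪 λs ! ∎
    where
    open ≡.≡-Reasoning
    D D∖c : List (MultiIndex m)
    D   = deduplicate _≟_ λs
    D∖c = filter (¬? ∘ (c ≟_)) D
    r : ℕ
    r = multiplicity c λs
    f : MultiIndex m → ℕ
    f d = multiplicity d λs !

  open DecTotalOrder (lexicographic m) using (totalOrder)
  open Sort (lexicographic m) using (sort; sort-↭; sort-↗) public

  -- A multiset has one sorted arrangement, so a partition is determined by its multiset of columns.
  -- The conversions arise because the equality underlying `lexicographic` is pointwise equality of
  -- vectors.
  ↗↭↗⇒≡ : ∀ {λs κs} → Sorted.Sorted totalOrder λs → Sorted.Sorted totalOrder κs → λs ↭ κs → λs ≡ κs
  ↗↭↗⇒≡ λs↗ κs↗ p = Pointwise.Pointwise-≡⇒≡ (Pointwise.map VecPointwise.Pointwise-≡⇒≡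
    (Sorted.↗↭↗⇒≋ totalOrder λs↗ κs↗ (Homogeneous.map VecPointwise.≡⇒Pointwise-≡ (↭⇒↭ₛ p))))

-- Insertion of a column into a partition.

⊕-⊖-below : ∀ {m} (i : MultiIndex m) {j} → j ∈ below i → j ⊕ (i ⊖ j) ≡ i
⊕-⊖-below []      {[]}    _  = ≡.refl
⊕-⊖-below (x ∷ i) j∈
  with y , j , y∈ , j∈ , ≡.refl ← ∈-cartesianProductWith⁻ _∷_ (upTo (suc x)) (below i) j∈ =
  ≡.cong₂ _∷_ (ℕ.m+[n∸m]≡n (ℕ.s≤s⁻¹ (∈-upTo⁻ y∈))) (⊕-⊖-below i j∈)

adjoinColumn : ∀ {m} → MultiIndex m → List (MultiIndex m) → List (MultiIndex m)
adjoinColumn c λs = sort (c ∷ λs)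

module _ {m} {c : MultiIndex m} (k : MultiIndex m) (c∈ : c ∈ below k) where

  adjoinColumn-⊢ : c ≢ 𝟎 → ∀ {λs} → IsPartition (k ⊖ c) λs → IsPartition k (adjoinColumn c λs)
  adjoinColumn-⊢ c≢𝟎 {λs} (isPartition λs≢𝟎 _ Σλs) = isPartition
    (↭.All-resp-↭ (↭-sym (sort-↭ (c ∷ λs))) (c≢𝟎 ∷ λs≢𝟎)) (sort-↗ (c ∷ λs))
    (≡.trans (foldr-⊕-↭ (sort-↭ (c ∷ λs))) (≡.trans (≡.cong (c ⊕_) Σλs) (⊕-⊖-below k c∈)))

  -- Deleting one copy of `c` undoes the insertion, since a partition is determined by its multiset
  -- of columns. Both lists are repetition-free, so mutual inclusion suffices.
  partitions-adjoinColumn : c ≢ 𝟎 → map (adjoinColumn c) (partitions (k ⊖ c)) ↭ filter (c ∈?_) (partitions k)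
  partitions-adjoinColumn c≢𝟎 = unique∧set⇒↭
    (map-unique (adjoinColumn c) injective (partitions-unique (k ⊖ c)))
    (Unique.filter⁺ (c ∈?_) (partitions-unique k)) to from
    where
    injective : ∀ {λs κs} → λs ∈ partitions (k ⊖ c) → κs ∈ partitions (k ⊖ c) →
                adjoinColumn c λs ≡ adjoinColumn c κs → λs ≡ κs
    injective {λs} {κs} λs∈ κs∈ eq = ↗↭↗⇒≡
      (IsPartition.sorted (partitions-sound (k ⊖ c) λs∈)) (IsPartition.sorted (partitions-sound (k ⊖ c) κs∈))
      (↭.drop-∷ (↭-trans (↭-sym (sort-↭ (c ∷ λs))) (≡.subst (_↭ c ∷ κs) (≡.sym eq) (sort-↭ (c ∷ κs)))))
    to : ∀ {κs} → κs ∈ map (adjoinColumn c) (partitions (k ⊖ c)) → κs ∈ filter (c ∈?_) (partitions k)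
    to κs∈ with λs , λs∈ , ≡.refl ← ∈-map⁻ (adjoinColumn c) κs∈ = ∈-filter⁺ (c ∈?_)
      (partitions-complete (adjoinColumn-⊢ c≢𝟎 (partitions-sound (k ⊖ c) λs∈)))
      (↭.∈-resp-↭ (↭-sym (sort-↭ (c ∷ λs))) (here ≡.refl))
    from : ∀ {κs} → κs ∈ filter (c ∈?_) (partitions k) → κs ∈ map (adjoinColumn c) (partitions (k ⊖ c))
    from κs∈ with κs∈ , c∈κs ← ∈-filter⁻ (c ∈?_) {xs = partitions k} κs∈
             with κ₁ , κ₂ , ≡.refl ← ∈-∃++ c∈κs =
      -- The preimage is the list without the occurrence of `c` that `∈-∃++` exhibits. Its row sums
      -- come from cancelling `c` by `⊕-⊖`; sorting it supplies the order condition at once.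
      ≡.subst (_∈ map (adjoinColumn c) (partitions (k ⊖ c))) (↗↭↗⇒≡ (sort-↗ (c ∷ λs)) κs↗ (↭-trans (sort-↭ (c ∷ λs)) (↭-sym κs↭)))
        (∈-map⁺ (adjoinColumn c) (partitions-complete (isPartition (All.tail (↭.All-resp-↭ κs↭ κs≢𝟎)) (sort-↗ (κ₁ ++ κ₂))
          (≡.trans (≡.sym (⊕-⊖ c _)) (≡.cong (_⊖ c) (≡.trans (≡.sym (foldr-⊕-↭ κs↭)) Σκs))))))
      where
      λs : List (MultiIndex m)
      λs = sort (κ₁ ++ κ₂)
      κs↭ : κ₁ ++ c ∷ κ₂ ↭ c ∷ λs
      κs↭ = ↭-trans (↭.shift c κ₁ κ₂) (prep c (↭-sym (sort-↭ (κ₁ ++ κ₂))))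
      κs⊢ : IsPartition k (κ₁ ++ c ∷ κ₂)
      κs⊢ = partitions-sound k κs∈
      open IsPartition κs⊢ renaming (columns≢𝟎 to κs≢𝟎; sorted to κs↗; row-sums to Σκs)

-- This makes `below k`, the index set of the Cauchy product, large enough to count all columns of a
-- partition of `k`.
∈-partition⇒∈-below : ∀ {m} {k : MultiIndex m} {λs} → IsPartition k λs → ∀ {c} → c ∈ λs → c ∈ below k
∈-partition⇒∈-below (isPartition _ _ ≡.refl) {c} c∈ with κ₁ , κ₂ , ≡.refl ← ∈-∃++ c∈ =
  ≡.subst (λ k → c ∈ below k) (≡.sym (foldr-⊕-↭ (↭.shift c κ₁ κ₂))) (below-complete c (foldr _⊕_ 𝟎 (κ₁ ++ κ₂)))

-- A partition of `k` has at most `∣ k ∣` columns, these being nonzero. Hence the exponent read off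
-- from `λs` survives the truncation to `degree≤ n ∣ i ∣` in `substitute`.
∣lengths∣≤ : ∀ {m} n (i : MultiIndex m) {ks λs} → ks ∈ decompositions n i → λs ∈ choices (Vec.map partitions ks) →
             ∣ Vec.map length λs ∣ ℕ.≤ ∣ i ∣
∣lengths∣≤ zero    i {[]} {[]} _ _ = ℕ.z≤n
∣lengths∣≤ (suc n) i {k ∷ ks} ks∈ λs∈
  with k′ , k′∈ , ks∈ ← find (∈-concatMap⁻ (λ k → map (k ∷_) (decompositions n (i ⊖ k))) {xs = below i} ks∈)
  with _ , ks′∈ , ≡.refl ← ∈-map⁻ (k′ ∷_) ks∈
  with κ , _ , κ∈ , κs∈ , ≡.refl ← ∈-cartesianProductWith⁻ _∷_ (partitions k) (choices (Vec.map partitions ks)) λs∈ =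
  ℕ.≤-trans (ℕ.+-mono-≤ (length≤∣∣ (partitions-sound k κ∈)) (∣lengths∣≤ n (i ⊖ k) ks′∈ κs∈)) (ℕ.≤-reflexive (∈-below i k′∈))
  where
  length≤∣∣ : ∀ {k λs} → IsPartition k λs → length λs ℕ.≤ ∣ k ∣
  length≤∣∣ (isPartition λs≢𝟎 _ ≡.refl) = length≤ λs≢𝟎

-- Finite sums, products and Iverson brackets in a commutative ring.

module Sums {c ℓ} (K : CommutativeRing c ℓ) where
  open CommutativeRing K hiding (zero)
  open FormalPowerSeries K
  open SetoidReasoning setoid
  open CommutativeSemigroupProperties *-commutativeSemigroup using ()
    renaming (x∙yz≈y∙xz to x*yz≈y*xz; interchange to *-interchange)
  open CommutativeSemigroupProperties +-commutativeSemigroup using () renaming (interchange to +-interchange)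
  open SemiringMult semiring using () renaming (_×_ to _×#_)
  open CommutativeMonoidSum *-commutativeMonoid public using ()
    renaming (sum-cong-≋ to ∏-cong; ∑-distrib-+ to ∏-distrib-*)

  module _ {b} {B : Set b} where

    ∑-cong : ∀ xs {f g : B → Carrier} → (∀ {x} → x ∈ xs → f x ≈ g x) → ∑ xs f ≈ ∑ xs g
    ∑-cong []       f≈g = refl
    ∑-cong (x ∷ xs) f≈g = +-cong (f≈g (here ≡.refl)) (∑-cong xs (f≈g ∘ there))

    ∑-++ : ∀ xs ys {f : B → Carrier} → ∑ (xs ++ ys) f ≈ ∑ xs f + ∑ ys f
    ∑-++ []       ys = sym (+-identityˡ _)
    ∑-++ (x ∷ xs) ys = trans (+-congˡ (∑-++ xs ys)) (sym (+-assoc _ _ _))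

    ∑-distribˡ : ∀ x ys (f : B → Carrier) → x * ∑ ys f ≈ ∑ ys (λ y → x * f y)
    ∑-distribˡ x []       f = zeroʳ x
    ∑-distribˡ x (y ∷ ys) f = trans (distribˡ x _ _) (+-congˡ (∑-distribˡ x ys f))

    ∑-distribʳ : ∀ x ys (f : B → Carrier) → ∑ ys f * x ≈ ∑ ys (λ y → f y * x)
    ∑-distribʳ x []       f = zeroˡ x
    ∑-distribʳ x (y ∷ ys) f = trans (distribʳ x _ _) (+-congˡ (∑-distribʳ x ys f))

    ∑-distrib-+ : ∀ xs (f g : B → Carrier) → ∑ xs (λ x → f x + g x) ≈ ∑ xs f + ∑ xs g
    ∑-distrib-+ []       f g = sym (+-identityˡ 0#)
    ∑-distrib-+ (x ∷ xs) f g = trans (+-congˡ (∑-distrib-+ xs f g)) (+-interchange _ _ _ _)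

    ∑-↭ : ∀ {xs ys} (f : B → Carrier) → xs ↭ ys → ∑ xs f ≈ ∑ ys f
    ∑-↭ f ↭.refl         = refl
    ∑-↭ f (↭.prep x p)   = +-congˡ (∑-↭ f p)
    ∑-↭ f (↭.swap x y p) = trans (+-congˡ (+-congˡ (∑-↭ f p)))
      (trans (sym (+-assoc _ _ _)) (trans (+-congʳ (+-comm _ _)) (+-assoc _ _ _)))
    ∑-↭ f (↭.trans p q)  = trans (∑-↭ f p) (∑-↭ f q)

    ∑-filter : ∀ {p} {P : B → Set p} (P? : Decidable P) xs {f : B → Carrier} →
               (∀ {x} → ¬ P x → f x ≈ 0#) → ∑ (filter P? xs) f ≈ ∑ xs f
    ∑-filter P? []       f≈0 = refl
    ∑-filter P? (x ∷ xs) f≈0 with P? x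
    ... | yes _  = +-congˡ (∑-filter P? xs f≈0)
    ... | no ¬px = trans (∑-filter P? xs f≈0) (sym (trans (+-congʳ (f≈0 ¬px)) (+-identityˡ _)))

  module _ {b d} {B : Set b} {D : Set d} where

    ∑-comm : ∀ xs (ys : List D) (f : B → D → Carrier) →
             ∑ xs (λ x → ∑ ys (λ y → f x y)) ≈ ∑ ys (λ y → ∑ xs (λ x → f x y))
    ∑-comm []       ys f = sym (∑-zero ys (λ _ → 0#) (λ _ → refl))
    ∑-comm (x ∷ xs) ys f = trans (+-congˡ (∑-comm xs ys f)) (sym (∑-distrib-+ ys (f x) _))

    ∑-map : ∀ (h : B → D) xs (f : D → Carrier) → ∑ (map h xs) f ≈ ∑ xs (f ∘ h)
    ∑-map h []       f = refl
    ∑-map h (x ∷ xs) f = +-congˡ (∑-map h xs f)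

    ∑-concatMap : ∀ (h : B → List D) xs (f : D → Carrier) →
                  ∑ (concatMap h xs) f ≈ ∑ xs (λ x → ∑ (h x) f)
    ∑-concatMap h []       f = refl
    ∑-concatMap h (x ∷ xs) f = trans (∑-++ (h x) (concatMap h xs)) (+-congˡ (∑-concatMap h xs f))

  ∑-cartesianProductWith : ∀ {b d e} {B : Set b} {D : Set d} {E : Set e} (h : B → D → E) xs ys (f : E → Carrier) →
                           ∑ (cartesianProductWith h xs ys) f ≈ ∑ xs (λ x → ∑ ys (λ y → f (h x y)))
  ∑-cartesianProductWith h []       ys f = refl
  ∑-cartesianProductWith h (x ∷ xs) ys f = trans (∑-++ (map (h x) ys) _)
    (+-cong (∑-map (h x) ys f) (∑-cartesianProductWith h xs ys f))

  -- The Iverson bracket. As a factor in the ring, a side condition of a sum can be moved through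
  -- products and exchanges of summation.
  ⟦_⟧ : ∀ {p} {P : Set p} → Dec P → Carrier
  ⟦ P? ⟧ = if does P? then 1# else 0#

  ⟦⟧-cong : ∀ {p q} {P : Set p} {Q : Set q} (P? : Dec P) (Q? : Dec Q) → (P → Q) → (Q → P) → ⟦ P? ⟧ ≈ ⟦ Q? ⟧
  ⟦⟧-cong (yes _) (yes _) P⇒Q Q⇒P = refl
  ⟦⟧-cong (no _)  (no _)  P⇒Q Q⇒P = refl
  ⟦⟧-cong (yes p) (no ¬q) P⇒Q Q⇒P = contradiction (P⇒Q p) ¬q
  ⟦⟧-cong (no ¬p) (yes q) P⇒Q Q⇒P = contradiction (Q⇒P q) ¬p

  -- Both sides vanish where `P` fails, so `P` may be assumed when the other factors are compared.
  *-⟦⟧-congʳ : ∀ {p} {P : Set p} (P? : Dec P) {x y z} → (P → x ≈ y) → x * (⟦ P? ⟧ * z) ≈ y * (⟦ P? ⟧ * z)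
  *-⟦⟧-congʳ (yes p) x≈y = *-congʳ (x≈y p)
  *-⟦⟧-congʳ (no _)  x≈y = trans (trans (*-congˡ (zeroˡ _)) (zeroʳ _)) (sym (trans (*-congˡ (zeroˡ _)) (zeroʳ _)))

  -- Without repetitions in `xs` the bracket holds at exactly one place. This singles out the empty
  -- partition and the exponent `a` later on.
  ∑-⟦⟧ : ∀ {b} {B : Set b} (_≟′_ : DecidableEquality B) {xs y} → Unique xs → y ∈ xs → (f : B → Carrier) →
         ∑ xs (λ x → ⟦ x ≟′ y ⟧ * f x) ≈ f y
  ∑-⟦⟧ _≟′_ {x ∷ xs} {y} (x∉ ∷ xs!) y∈ f with x ≟′ y | y∈
  ... | yes ≡.refl | _            = trans (+-cong (*-identityˡ _) (∑-zero xs _ others)) (+-identityʳ _)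
    where
    others : ∀ {z} → z ∈ xs → ⟦ z ≟′ y ⟧ * f z ≈ 0#
    others {z} z∈ with z ≟′ y
    ... | yes ≡.refl = contradiction ≡.refl (All.lookup x∉ z∈)
    ... | no _       = zeroˡ _
  ... | no x≢y     | here ≡.refl  = contradiction ≡.refl x≢y
  ... | no _       | there y∈xs   = trans (+-cong (zeroˡ _) (∑-⟦⟧ _≟′_ xs! y∈xs f)) (+-identityˡ _)

  multiplicity-⟦⟧ : ∀ {m} (c : MultiIndex m) λs → multiplicity c λs ×# 1# ≈ ∑ λs (λ d → ⟦ c ≟ d ⟧)
  multiplicity-⟦⟧ c []       = refl
  multiplicity-⟦⟧ c (d ∷ λs) with c ≟ d
  ... | yes _ = +-congˡ (multiplicity-⟦⟧ c λs)
  ... | no  _ = trans (multiplicity-⟦⟧ c λs) (sym (+-identityˡ _))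

  -- Double counting of the pairs of a value `c` in `U` and a position in `λs` that holds it.
  ∑-multiplicity : ∀ {m} {U : List (MultiIndex m)} → Unique U → ∀ λs → (∀ {d} → d ∈ λs → d ∈ U) →
                   ∑ U (λ c → multiplicity c λs ×# 1#) ≈ length λs ×# 1#
  ∑-multiplicity {U = U} U! λs λs⊆U = begin
    ∑ U (λ c → multiplicity c λs ×# 1#)     ≈⟨ ∑-cong U (λ {c} _ → multiplicity-⟦⟧ c λs) ⟩
    ∑ U (λ c → ∑ λs (λ d → ⟦ c ≟ d ⟧))      ≈⟨ ∑-comm U λs _ ⟩
    ∑ λs (λ d → ∑ U (λ c → ⟦ c ≟ d ⟧))      ≈⟨ ∑-cong λs (λ d∈ → trans (∑-cong U (λ _ → sym (*-identityʳ _))) (∑-⟦⟧ _≟_ U! (λs⊆U d∈) (λ _ → 1#))) ⟩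
    ∑ λs (λ _ → 1#)                          ≈⟨ ∑-1 λs ⟩
    length λs ×# 1#                          ∎
    where
    ∑-1 : ∀ {b} {B : Set b} (xs : List B) → ∑ xs (λ _ → 1#) ≈ length xs ×# 1#
    ∑-1 []       = refl
    ∑-1 (x ∷ xs) = +-congˡ (∑-1 xs)

  ∏-∑ : ∀ {b} {B : Set b} {n} (xss : Vec (List B) n) (f : Fin n → B → Carrier) →
        ∏ (λ j → ∑ (lookup xss j) (f j)) ≈ ∑ (choices xss) (λ xs → ∏ (λ j → f j (lookup xs j)))
  ∏-∑ []         f = sym (+-identityʳ 1#)
  ∏-∑ (xs ∷ xss) f = begin
    ∑ xs (f zero) * ∏ (λ j → ∑ (lookup xss j) (f (suc j)))
      ≈⟨ *-congˡ (∏-∑ xss (f ∘ suc)) ⟩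
    ∑ xs (f zero) * ∑ (choices xss) F
      ≈⟨ ∑-distribʳ _ xs (f zero) ⟩
    ∑ xs (λ x → f zero x * ∑ (choices xss) F)
      ≈⟨ ∑-cong xs (λ _ → ∑-distribˡ _ (choices xss) F) ⟩
    ∑ xs (λ x → ∑ (choices xss) (λ ys → f zero x * F ys))
      ≈⟨ ∑-cartesianProductWith _∷_ xs (choices xss) _ ⟨
    ∑ (choices (xs ∷ xss)) (λ ys → ∏ (λ j → f j (lookup ys j))) ∎
    where
    F : Vec _ _ → Carrier
    F ys = ∏ (λ j → f (suc j) (lookup ys j))

  ∏-⟦⟧ : ∀ {b} {B : Set b} {n} (h : B → ℕ) (a : MultiIndex n) (xs : Vec B n) →
         ∏ (λ j → ⟦ lookup a j ℕ.≟ h (lookup xs j) ⟧) ≈ ⟦ a ≟ Vec.map h xs ⟧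
  ∏-⟦⟧ h []      []       = refl
  ∏-⟦⟧ h (p ∷ a) (x ∷ xs) = trans (*-congˡ (∏-⟦⟧ h a xs)) ∷-⟦⟧
    where
    ∷-⟦⟧ : ⟦ p ℕ.≟ h x ⟧ * ⟦ a ≟ Vec.map h xs ⟧ ≈ ⟦ p ∷ a ≟ h x ∷ Vec.map h xs ⟧
    -- `does` of the test on the whole vectors reduces to the conjunction for head and tail, so a
    -- split on the head is enough.
    ∷-⟦⟧ with does (p ℕ.≟ h x)
    ... | true = *-identityˡ _
    ... | false = zeroˡ _

  -- `decompositions` recurses through `below` and `_⊖_` exactly as the Cauchy product `_*ˢ_` does,
  -- so iterating the latter runs over the former.
  ∏ˢ-coefficient : ∀ {m n} (t : Vector (Series m) n) i →
                   ∏ˢ t i ≈ ∑ (decompositions n i) (λ ks → ∏ (λ j → t j (lookup ks j)))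
  ∏ˢ-coefficient {n = zero} t i with does (i ≟ 𝟎)
  ... | true  = sym (+-identityʳ 1#)
  ... | false = refl
  ∏ˢ-coefficient {n = suc n} t i = begin
    ∑ (below i) (λ k → t zero k * ∏ˢ (t ∘ suc) (i ⊖ k))
      ≈⟨ ∑-cong (below i) (λ {k} _ → trans (*-congˡ (∏ˢ-coefficient (t ∘ suc) (i ⊖ k))) (∑-distribˡ _ (decompositions n (i ⊖ k)) _)) ⟩
    ∑ (below i) (λ k → ∑ (decompositions n (i ⊖ k)) (λ ks → t zero k * ∏ (λ j → t (suc j) (lookup ks j))))
      ≈⟨ ∑-cong (below i) (λ {k} _ → ∑-map (k ∷_) (decompositions n (i ⊖ k)) _) ⟨
    ∑ (below i) (λ k → ∑ (map (k ∷_) (decompositions n (i ⊖ k))) (λ ks → ∏ (λ j → t j (lookup ks j))))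
      ≈⟨ ∑-concatMap _ (below i) _ ⟨
    ∑ (decompositions (suc n) i) (λ ks → ∏ (λ j → t j (lookup ks j))) ∎

-- Natural numbers and their inverses in a field of characteristic zero.

module AuxiliaryUmbra {c ℓ₁ ℓ₂ a} (R : HeytingField c ℓ₁ ℓ₂) (char0 : CharacteristicZero R) (A : Set a) where
  open HeytingField R using (#⇒invertible)
  open UmbralCalculus R char0 A
  open CommutativeRing commutativeRing hiding (zero)
  open Sums commutativeRing
  open SetoidReasoning setoid
  open RingProperties ring using (-0#≈0#)
  open CommutativeSemigroupProperties *-commutativeSemigroup using () renaming (x∙yz≈y∙xz to x*yz≈y*xz)
  open SemiringMult semiring using (×1-homo-*) renaming (_×_ to _×#_; ×-homo-1 to ×#-homo-1)
  open CommutativeMonoidSolver *-commutativeMonoid using (solve; _⊜_) renaming (_⊕_ to _:*_)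

  ι : ℕ → Carrier
  ι p = p ×# 1#

  ι-1/ : ∀ d .{{_ : NonZero d}} → ι d * (1 / d) ≈ 1#
  ι-1/ d = begin
    ι d * (1 ×# 1# * proj₁ inverse)  ≈⟨ *-congˡ (trans (*-congʳ (×#-homo-1 1#)) (*-identityˡ _)) ⟩
    -- Apartness from `0#` yields an inverse of the difference `ι d - 0#`, whence the rewriting of
    -- `ι d`.
    ι d * proj₁ inverse              ≈⟨ *-congʳ (trans (+-congˡ -0#≈0#) (+-identityʳ _)) ⟨
    (ι d - 0#) * proj₁ inverse       ≈⟨ proj₂ (proj₂ inverse) ⟩
    1# ∎
    where inverse = #⇒invertible (char0 d)

  /≈ : ∀ p d .{{_ : NonZero d}} → p / d ≈ ι p * (1 / d)
  /≈ p d = *-congˡ (sym (trans (*-congʳ (×#-homo-1 1#)) (*-identityˡ _)))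

  1/-unique : ∀ d .{{_ : NonZero d}} {x} → ι d * x ≈ 1# → x ≈ 1 / d
  1/-unique d {x} dx≈1 = begin
    x                      ≈⟨ *-identityˡ x ⟨
    1# * x                 ≈⟨ *-congʳ (ι-1/ d) ⟨
    ι d * (1 / d) * x      ≈⟨ solve 3 (λ p q r → (p :* q) :* r ⊜ (p :* r) :* q) refl (ι d) (1 / d) x ⟩
    ι d * x * (1 / d)      ≈⟨ trans (*-congʳ dx≈1) (*-identityˡ _) ⟩
    1 / d ∎

  -- The `NonZero` arguments are irrelevant, so equal denominators give the same inverse whatever
  -- the instances.
  1/-cong : ∀ {d e} .{{_ : NonZero d}} .{{_ : NonZero e}} → d ≡ e → 1 / d ≈ 1 / e
  1/-cong ≡.refl = refl

  1/-* : ∀ d e .{{_ : NonZero d}} .{{_ : NonZero e}} → (1 / (d ℕ.* e)) {{ℕ.m*n≢0 d e}} ≈ (1 / d) * (1 / e)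
  1/-* d e = sym (1/-unique (d ℕ.* e) {{ℕ.m*n≢0 d e}} (begin
    ι (d ℕ.* e) * ((1 / d) * (1 / e))      ≈⟨ *-congʳ (×1-homo-* d e) ⟩
    ι d * ι e * ((1 / d) * (1 / e))        ≈⟨ solve 4 (λ p q r s → (p :* q) :* (r :* s) ⊜ (p :* r) :* (q :* s)) refl (ι d) (ι e) (1 / d) (1 / e) ⟩
    ι d * (1 / d) * (ι e * (1 / e))        ≈⟨ *-cong (ι-1/ d) (ι-1/ e) ⟩
    1# * 1#                                ≈⟨ *-identityˡ 1# ⟩
    1# ∎))

  ι-product : ∀ {b} {B : Set b} {n} (f : B → ℕ) (xs : Vec B n) →
              ι (ℕ.product (map f (toList xs))) ≈ ∏ (λ j → ι (f (lookup xs j)))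
  ι-product f []       = ×#-homo-1 1#
  ι-product f (x ∷ xs) = trans (×1-homo-* (f x) _) (*-congˡ (ι-product f xs))

  -- Coefficients of generating functions and powers of one series `f(ν , t) - 1`.

  module _ (evaluation : Evaluation) where
    open Evaluation evaluation

    moment-𝟎 : ∀ {k} (μ : Vector Monomial k) → moment evaluation μ 𝟎 ≈ 1#
    moment-𝟎 {k} μ = trans (E-cong (∏ᴾ-1 k μ)) normalized
      where
      open LeftModuleMorphisms.IsLeftModuleHomomorphism linear using () renaming (⟦⟧-cong to E-cong)
      ∏ᴾ-1 : ∀ k (μ : Vector Monomial k) → ∏ᴾ (λ j → Monomial.toPolynomial (μ j) ^ᴾ lookup 𝟎 j) ≈ᴾ con 1#
      ∏ᴾ-1 zero    μ = reflᴾ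
      ∏ᴾ-1 (suc k) μ = transᴾ (*-identityᴾ _) (∏ᴾ-1 k (μ ∘ suc))

    -- Removes the case distinction in `genFun`: the prescribed constant term agrees with the
    -- general formula because `E` is normalized and `𝟎 !ᵐ` is 1.
    genFun-coefficient : ∀ {k} (μ : Vector Monomial k) i →
                         genFun evaluation μ i ≈ moment evaluation μ i * (1 / i !ᵐ) {{i !ᵐ≢0}}
    genFun-coefficient {k} μ i with i ≟ 𝟎
    ... | no _       = refl
    -- The moment and `ι (𝟎 !ᵐ)` both equal 1; one replaces the other in order to cancel the
    -- inverse.
    ... | yes ≡.refl = sym (trans (*-cong (trans (moment-𝟎 μ) (sym (trans (ι-product _! (𝟎 {k})) (∏-𝟎! k)))) refl) (ι-1/ (𝟎 {k} !ᵐ) {{𝟎 {k} !ᵐ≢0}}))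
      where
      ∏-𝟎! : ∀ k → ∏ (λ j → ι (lookup (𝟎 {k}) j !)) ≈ 1#
      ∏-𝟎! zero    = refl
      ∏-𝟎! (suc k) = trans (*-cong (×#-homo-1 1#) (∏-𝟎! k)) (*-identityˡ 1#)

    module _ {m} (ν : Vector Monomial m) where

      genFun-1-coefficient : ∀ {c} → c ≢ 𝟎 → genFun-1 evaluation ν c ≈ moment evaluation ν c * (1 / c !ᵐ) {{c !ᵐ≢0}}
      genFun-1-coefficient {c} c≢𝟎 with c ≟ 𝟎
      ... | yes c≡𝟎 = contradiction c≡𝟎 c≢𝟎
      ... | no _    = trans (+-congˡ -0#≈0#) (+-identityʳ _)

      partitionMoment-↭ : ∀ {λs κs} → λs ↭ κs → partitionMoment evaluation ν λs ≈ partitionMoment evaluation ν κs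
      partitionMoment-↭ ↭.refl         = refl
      partitionMoment-↭ (↭.prep k p)   = *-congˡ (partitionMoment-↭ p)
      partitionMoment-↭ (↭.swap j k p) = trans (*-congˡ (*-congˡ (partitionMoment-↭ p))) (x*yz≈y*xz _ _ _)
      partitionMoment-↭ (↭.trans p q)  = trans (partitionMoment-↭ p) (partitionMoment-↭ q)

      -- Unlike the coefficients in `auxMoment`, it omits the factor `k !ᵐ` and so depends on the
      -- columns alone.
      weight : List (MultiIndex m) → Carrier
      weight λs = partitionMoment evaluation ν λs * (1 / (𝔪 λs ! ℕ.* λs !ˡ)) {{𝔪 λs !*!ˡ≢0}}

      weight-↭ : ∀ {λs κs} → λs ↭ κs → weight λs ≈ weight κs
      weight-↭ {λs} {κs} p = *-cong (partitionMoment-↭ p)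
        (1/-cong {{𝔪 λs !*!ˡ≢0}} {{𝔪 κs !*!ˡ≢0}} (≡.cong₂ ℕ._*_ (𝔪-↭ p) (!ˡ-↭ p)))

      -- The new column contributes its moment to `h`, `c !ᵐ` to the product of entry factorials,
      -- and `suc (multiplicity c λs)` to `𝔪_!` by `𝔪-∷`. The first two form the coefficient of the
      -- series at `c`; the third cancels.
      weight-∷ : ∀ {c} → c ≢ 𝟎 → ∀ λs → ι (suc (multiplicity c λs)) * weight (c ∷ λs) ≈ genFun-1 evaluation ν c * weight λs
      weight-∷ {c} c≢𝟎 λs = begin
        ι r * (moment evaluation ν c * h * (1 / (𝔪 c ∷ λs ! ℕ.* (c ∷ λs) !ˡ)) {{𝔪 c ∷ λs !*!ˡ≢0}})
          ≈⟨ *-congˡ (*-congˡ (trans (1/-cong {{𝔪 c ∷ λs !*!ˡ≢0}} {{ℕ.m*n≢0 r (c !ᵐ ℕ.* d)}} factorials)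
               (trans (1/-* r (c !ᵐ ℕ.* d)) (*-congˡ (1/-* (c !ᵐ) d))))) ⟩
        ι r * (moment evaluation ν c * h * ((1 / r) * ((1 / c !ᵐ) * (1 / d))))
          ≈⟨ solve 6 (λ p q s t u v → p :* ((q :* s) :* (t :* (u :* v))) ⊜ (p :* t) :* ((q :* u) :* (s :* v))) refl
               (ι r) (moment evaluation ν c) h (1 / r) (1 / c !ᵐ) (1 / d) ⟩
        ι r * (1 / r) * (moment evaluation ν c * (1 / c !ᵐ) * weight λs)
          ≈⟨ trans (*-congʳ (ι-1/ r)) (*-identityˡ _) ⟩
        moment evaluation ν c * (1 / c !ᵐ) * weight λs
          ≈⟨ *-congʳ (genFun-1-coefficient c≢𝟎) ⟨
        genFun-1 evaluation ν c * weight λs ∎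
        where
        r d : ℕ
        r = suc (multiplicity c λs)
        d = 𝔪 λs ! ℕ.* λs !ˡ
        h : Carrier
        h = partitionMoment evaluation ν λs
        instance
          c!≢0 : NonZero (c !ᵐ)
          c!≢0 = c !ᵐ≢0
          d≢0 : NonZero d
          d≢0 = 𝔪 λs !*!ˡ≢0
          c!d≢0 : NonZero (c !ᵐ ℕ.* d)
          c!d≢0 = ℕ.m*n≢0 (c !ᵐ) d
        open CommutativeSemigroupProperties ℕ.*-commutativeSemigroup using (x∙yz≈y∙xz)
        factorials : 𝔪 c ∷ λs ! ℕ.* (c ∷ λs) !ˡ ≡ r ℕ.* (c !ᵐ ℕ.* d)
        factorials = ≡.trans (≡.cong (ℕ._* (c ∷ λs) !ˡ) (𝔪-∷ c λs))
          (≡.trans (ℕ.*-assoc r (𝔪 λs !) ((c ∷ λs) !ˡ)) (≡.cong (r ℕ.*_) (x∙yz≈y∙xz (𝔪 λs !) (c !ᵐ) (λs !ˡ))))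

      -- Up to the factor `k !ᵐ`, the multivariate partial Bell polynomial in the moments of `ν`.
      partitionSum : ℕ → Series m
      partitionSum l k = ∑ (partitions k) (λ λs → ⟦ l ℕ.≟ length λs ⟧ * weight λs)

      -- By `weight-∷`, multiplying by the coefficient at `c` amounts to inserting the column `c`.
      -- Summed over `c`, the left side is a coefficient of a Cauchy product.
      partitionSum-column : ∀ l k {c} → c ∈ below k →
        genFun-1 evaluation ν c * partitionSum l (k ⊖ c) ≈
        ∑ (partitions k) (λ λs → ι (multiplicity c λs) * (⟦ suc l ℕ.≟ length λs ⟧ * weight λs))
      partitionSum-column l k {c} c∈ = by-cases (c ≟ 𝟎)
        where
        F : List (MultiIndex m) → Carrier
        F λs = ι (multiplicity c λs) * (⟦ suc l ℕ.≟ length λs ⟧ * weight λs)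
        adjoin : c ≢ 𝟎 → ∀ λs → genFun-1 evaluation ν c * (⟦ l ℕ.≟ length λs ⟧ * weight λs) ≈ F (adjoinColumn c λs)
        adjoin c≢𝟎 λs = begin
          genFun-1 evaluation ν c * (⟦ l ℕ.≟ length λs ⟧ * weight λs)
            ≈⟨ x*yz≈y*xz _ _ _ ⟩
          ⟦ l ℕ.≟ length λs ⟧ * (genFun-1 evaluation ν c * weight λs)
            ≈⟨ *-cong (⟦⟧-cong (l ℕ.≟ length λs) (suc l ℕ.≟ suc (length λs)) (≡.cong suc) ℕ.suc-injective) (sym (weight-∷ c≢𝟎 λs)) ⟩
          ⟦ suc l ℕ.≟ suc (length λs) ⟧ * (ι (suc (multiplicity c λs)) * weight (c ∷ λs))
            ≈⟨ x*yz≈y*xz _ _ _ ⟩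
          ι (suc (multiplicity c λs)) * (⟦ suc l ℕ.≟ suc (length λs) ⟧ * weight (c ∷ λs))
            ≈⟨ *-cong
                 (reflexive (≡.cong ι (≡.trans (≡.sym (multiplicity-∷-≡ c λs)) (multiplicity-↭ c (↭.↭-sym (sort-↭ (c ∷ λs)))))))
                 (*-cong (reflexive (≡.cong (λ n → ⟦ suc l ℕ.≟ n ⟧) (↭.↭-length (↭.↭-sym (sort-↭ (c ∷ λs))))))
                   (weight-↭ (↭.↭-sym (sort-↭ (c ∷ λs))))) ⟩
          F (adjoinColumn c λs) ∎
        by-cases : Dec (c ≡ 𝟎) → genFun-1 evaluation ν c * partitionSum l (k ⊖ c) ≈ ∑ (partitions k) F
        -- Both sides vanish at `𝟎`: the series has no constant term, and no partition has a zero
        -- column.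
        by-cases (yes ≡.refl) = trans (trans (*-congʳ (genFun-1-withoutConstantTerm evaluation ν)) (zeroˡ _))
          (sym (∑-zero (partitions k) _ λ {λs} λs∈ → trans (*-congʳ (reflexive (≡.cong ι
            (∉⇒multiplicity≡0 λ 𝟎∈ → All.lookup (IsPartition.columns≢𝟎 (partitions-sound k λs∈)) 𝟎∈ ≡.refl)))) (zeroˡ _)))
        by-cases (no c≢𝟎) = begin
          genFun-1 evaluation ν c * partitionSum l (k ⊖ c)
            ≈⟨ ∑-distribˡ _ (partitions (k ⊖ c)) _ ⟩
          ∑ (partitions (k ⊖ c)) (λ λs → genFun-1 evaluation ν c * (⟦ l ℕ.≟ length λs ⟧ * weight λs))
            ≈⟨ ∑-cong (partitions (k ⊖ c)) (λ {λs} _ → adjoin c≢𝟎 λs) ⟩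
          ∑ (partitions (k ⊖ c)) (F ∘ adjoinColumn c)
            ≈⟨ ∑-map (adjoinColumn c) (partitions (k ⊖ c)) F ⟨
          ∑ (map (adjoinColumn c) (partitions (k ⊖ c))) F
            ≈⟨ ∑-↭ F (partitions-adjoinColumn k c∈ c≢𝟎) ⟩
          ∑ (filter (c ∈?_) (partitions k)) F
            -- Partitions without `c` may be added back, as their factor `ι (multiplicity c λs)` is
            -- zero.
            ≈⟨ ∑-filter (c ∈?_) (partitions k) (λ {λs} c∉ → trans (*-congʳ (reflexive (≡.cong ι (∉⇒multiplicity≡0 c∉)))) (zeroˡ _)) ⟩
          ∑ (partitions k) F ∎

      partitionSum-zero : ∀ k → partitionSum 0 k ≈ 1ˢ k
      partitionSum-zero k = by-cases (k ≟ 𝟎)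
        where
        length≡0 : ∀ (λs : List (MultiIndex m)) → 0 ≡ length λs → λs ≡ []
        length≡0 [] _ = ≡.refl
        -- `1ˢ k` is `⟦ k ≟ 𝟎 ⟧` by definition, so the split is on that very decision. Only the
        -- empty partition has length 0, and its row sums are `𝟎`.
        by-cases : (k≟𝟎 : Dec (k ≡ 𝟎)) → partitionSum 0 k ≈ ⟦ k≟𝟎 ⟧
        by-cases (no k≢𝟎) = ∑-zero (partitions k) _ λ { {[]} λs∈ → contradiction (≡.sym (IsPartition.row-sums (partitions-sound k λs∈))) k≢𝟎 ; {_ ∷ _} _ → zeroˡ _ }
        by-cases (yes ≡.refl) = begin
          partitionSum 0 𝟎
            ≈⟨ ∑-cong (partitions 𝟎) (λ {λs} _ → *-congʳ (⟦⟧-cong (0 ℕ.≟ length λs) (List.≡-dec _≟_ λs []) (length≡0 λs) λ { ≡.refl → ≡.refl })) ⟩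
          ∑ (partitions 𝟎) (λ λs → ⟦ List.≡-dec _≟_ λs [] ⟧ * weight λs)
            ≈⟨ ∑-⟦⟧ (List.≡-dec _≟_) (partitions-unique 𝟎) (partitions-complete (isPartition All.[] Linked.[] ≡.refl)) weight ⟩
          1# * (1 / 1)
            ≈⟨ *-congʳ (×#-homo-1 1#) ⟨
          ι 1 * (1 / 1)
            ≈⟨ ι-1/ 1 ⟩
          1# ∎

      ^-coefficient : ∀ l k → (genFun-1 evaluation ν ^ˢ l) k ≈ ι (l !) * partitionSum l k
      ^-coefficient zero    k = sym (trans (*-congʳ (×#-homo-1 1#)) (trans (*-identityˡ _) (partitionSum-zero k)))
      ^-coefficient (suc l) k = begin
        ∑ (below k) (λ c → s c * (s ^ˢ l) (k ⊖ c))
          ≈⟨ ∑-cong (below k) (λ {c} _ → trans (*-congˡ (^-coefficient l (k ⊖ c))) (x*yz≈y*xz _ _ _)) ⟩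
        ∑ (below k) (λ c → ι (l !) * (s c * partitionSum l (k ⊖ c)))
          ≈⟨ ∑-distribˡ _ (below k) _ ⟨
        ι (l !) * ∑ (below k) (λ c → s c * partitionSum l (k ⊖ c))
          ≈⟨ *-congˡ (∑-cong (below k) (λ c∈ → partitionSum-column l k c∈)) ⟩
        ι (l !) * ∑ (below k) (λ c → ∑ (partitions k) (λ λs → ι (multiplicity c λs) * F λs))
          ≈⟨ *-congˡ (∑-comm (below k) (partitions k) _) ⟩
        ι (l !) * ∑ (partitions k) (λ λs → ∑ (below k) (λ c → ι (multiplicity c λs) * F λs))
          -- All columns lie in `below k`, so the multiplicities add up to `length λs`, which the
          -- bracket in `F` turns into `suc l`.
          ≈⟨ *-congˡ (∑-cong (partitions k) (λ {λs} λs∈ → trans (sym (∑-distribʳ _ (below k) _))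
               (trans (*-congʳ (∑-multiplicity (below-unique k) λs (∈-partition⇒∈-below (partitions-sound k λs∈)))) (length≡suc λs)))) ⟩
        ι (l !) * ∑ (partitions k) (λ λs → ι (suc l) * F λs)
          ≈⟨ *-congˡ (∑-distribˡ _ (partitions k) F) ⟨
        ι (l !) * (ι (suc l) * partitionSum (suc l) k)
          ≈⟨ trans (x*yz≈y*xz _ _ _) (sym (*-assoc _ _ _)) ⟩
        ι (suc l) * ι (l !) * partitionSum (suc l) k
          ≈⟨ *-congʳ (×1-homo-* (suc l) (l !)) ⟨
        ι (suc l !) * partitionSum (suc l) k ∎
        where
        s : Series m
        s = genFun-1 evaluation ν
        F : List (MultiIndex m) → Carrier
        F λs = ⟦ suc l ℕ.≟ length λs ⟧ * weight λs
        length≡suc : ∀ λs → ι (length λs) * F λs ≈ ι (suc l) * F λs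
        length≡suc λs = *-⟦⟧-congʳ (suc l ℕ.≟ length λs) (λ eq → reflexive (≡.cong ι (≡.sym eq)))

    -- Both sides of the identity, coefficient by coefficient.

    module _ {m n} (μ : Vector Monomial n) (ν : Fin n → Vector Monomial m) where

      s : Vector (Series m) n
      s j = genFun-1 evaluation (ν j)

      expansion : Vec (List (MultiIndex m)) n → Carrier
      expansion λs = ∏ (λ j → weight (ν j) (lookup λs j))

      -- The common shape of both sides: once the factorials of the `ks` have cancelled, summands
      -- depend on the partitions alone.
      sumOver : MultiIndex m → (Vec (List (MultiIndex m)) n → Carrier) → Carrier
      sumOver i f = ∑ (decompositions n i) (λ ks → ∑ (choices (Vec.map partitions ks)) f)

      -- The factorials of the `ks` in the partition coefficients cancel the denominator of the
      -- multinomial coefficient, and `i !ᵐ` cancels against the exponential normalization.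
      auxGenFun-coefficient : ∀ i → auxGenFun evaluation μ ν i ≈
        sumOver i (λ λs → expansion λs * moment evaluation μ (Vec.map length λs))
      auxGenFun-coefficient i = trans (∑-distribʳ _ (decompositions n i) _) (∑-cong (decompositions n i) λ {ks} _ → summand ks)
        where
        M : Vec (List (MultiIndex m)) n → Carrier
        M λs = moment evaluation μ (Vec.map length λs)
        W : Vec (MultiIndex m) n → Vec (List (MultiIndex m)) n → Carrier
        W ks λs = ∏ (λ j → (lookup ks j !ᵐ / (𝔪 lookup λs j ! ℕ.* lookup λs j !ˡ)) {{𝔪 lookup λs j !*!ˡ≢0}} * partitionMoment evaluation (ν j) (lookup λs j))
        W≈ : ∀ ks λs → W ks λs ≈ ι (toList ks !ˡ) * expansion λs
        W≈ ks λs = begin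
          W ks λs
            ≈⟨ ∏-cong (λ j → trans (*-congʳ (/≈ (lookup ks j !ᵐ) _ {{𝔪 lookup λs j !*!ˡ≢0}})) (trans (*-assoc _ _ _) (*-congˡ (*-comm _ _)))) ⟩
          ∏ (λ j → ι (lookup ks j !ᵐ) * weight (ν j) (lookup λs j))
            ≈⟨ ∏-distrib-* (λ j → ι (lookup ks j !ᵐ)) _ ⟩
          ∏ (λ j → ι (lookup ks j !ᵐ)) * expansion λs
            ≈⟨ *-congʳ (ι-product _!ᵐ ks) ⟨
          ι (toList ks !ˡ) * expansion λs ∎
        summand : ∀ ks → (i !ᵐ / toList ks !ˡ) {{toList ks !ˡ≢0}} * ∑ (choices (Vec.map partitions ks)) (λ λs → W ks λs * M λs) * (1 / i !ᵐ) {{i !ᵐ≢0}}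
                        ≈ ∑ (choices (Vec.map partitions ks)) (λ λs → expansion λs * M λs)
        summand ks = begin
          (i !ᵐ / toList ks !ˡ) * ∑ L (λ λs → W ks λs * M λs) * (1 / i !ᵐ)
            ≈⟨ *-congʳ (*-cong (/≈ (i !ᵐ) (toList ks !ˡ)) (trans (∑-cong L (λ {λs} _ → trans (*-congʳ (W≈ ks λs)) (*-assoc _ _ _))) (sym (∑-distribˡ _ L _)))) ⟩
          ι (i !ᵐ) * (1 / toList ks !ˡ) * (ι (toList ks !ˡ) * S) * (1 / i !ᵐ)
            ≈⟨ solve 5 (λ p q r t u → ((p :* q) :* (r :* t)) :* u ⊜ (p :* u) :* ((r :* q) :* t)) refl
                 (ι (i !ᵐ)) (1 / toList ks !ˡ) (ι (toList ks !ˡ)) S (1 / i !ᵐ) ⟩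
          ι (i !ᵐ) * (1 / i !ᵐ) * (ι (toList ks !ˡ) * (1 / toList ks !ˡ) * S)
            ≈⟨ *-cong (ι-1/ (i !ᵐ)) (*-congʳ (ι-1/ (toList ks !ˡ))) ⟩
          1# * (1# * S)
            ≈⟨ trans (*-identityˡ _) (*-identityˡ _) ⟩
          S ∎
          where
          L : List (Vec (List (MultiIndex m)) n)
          L = choices (Vec.map partitions ks)
          S : Carrier
          S = ∑ L (λ λs → expansion λs * M λs)
          instance
            i!≢0 : NonZero (i !ᵐ)
            i!≢0 = i !ᵐ≢0
            ks!≢0 : NonZero (toList ks !ˡ)
            ks!≢0 = toList ks !ˡ≢0

      -- The product over `j` of `^-coefficient`: the factorials multiply to `a !ᵐ`, and the
      -- conditions on single lengths merge into one equation of vectors.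
      ^ᵐ-coefficient : ∀ a i → (s ^ᵐ a) i ≈ ι (a !ᵐ) * sumOver i (λ λs → ⟦ a ≟ Vec.map length λs ⟧ * expansion λs)
      ^ᵐ-coefficient a i = begin
        (s ^ᵐ a) i
          ≈⟨ ∏ˢ-coefficient (λ j → s j ^ˢ lookup a j) i ⟩
        ∑ (decompositions n i) (λ ks → ∏ (λ j → (s j ^ˢ lookup a j) (lookup ks j)))
          ≈⟨ ∑-cong (decompositions n i) (λ {ks} _ → summand ks) ⟩
        ∑ (decompositions n i) (λ ks → ι (a !ᵐ) * ∑ (choices (Vec.map partitions ks)) (λ λs → ⟦ a ≟ Vec.map length λs ⟧ * expansion λs))
          ≈⟨ ∑-distribˡ _ (decompositions n i) _ ⟨
        ι (a !ᵐ) * sumOver i (λ λs → ⟦ a ≟ Vec.map length λs ⟧ * expansion λs) ∎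
        where
        F : Fin n → List (MultiIndex m) → Carrier
        F j κ = ⟦ lookup a j ℕ.≟ length κ ⟧ * weight (ν j) κ
        summand : ∀ ks → ∏ (λ j → (s j ^ˢ lookup a j) (lookup ks j)) ≈
                         ι (a !ᵐ) * ∑ (choices (Vec.map partitions ks)) (λ λs → ⟦ a ≟ Vec.map length λs ⟧ * expansion λs)
        summand ks = begin
          ∏ (λ j → (s j ^ˢ lookup a j) (lookup ks j))
            ≈⟨ ∏-cong (λ j → ^-coefficient (ν j) (lookup a j) (lookup ks j)) ⟩
          ∏ (λ j → ι (lookup a j !) * ∑ (partitions (lookup ks j)) (F j))
            ≈⟨ ∏-distrib-* (λ j → ι (lookup a j !)) _ ⟩
          ∏ (λ j → ι (lookup a j !)) * ∏ (λ j → ∑ (partitions (lookup ks j)) (F j))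
            ≈⟨ *-cong (sym (ι-product _! a)) (∏-cong (λ j → reflexive (≡.cong (λ κs → ∑ κs (F j)) (≡.sym (Vec.lookup-map j partitions ks))))) ⟩
          ι (a !ᵐ) * ∏ (λ j → ∑ (lookup (Vec.map partitions ks) j) (F j))
            ≈⟨ *-congˡ (∏-∑ (Vec.map partitions ks) F) ⟩
          ι (a !ᵐ) * ∑ (choices (Vec.map partitions ks)) (λ λs → ∏ (λ j → F j (lookup λs j)))
            ≈⟨ *-congˡ (∑-cong (choices (Vec.map partitions ks)) (λ {λs} _ →
                 trans (∏-distrib-* (λ j → ⟦ lookup a j ℕ.≟ length (lookup λs j) ⟧) _) (*-congʳ (∏-⟦⟧ length a λs)))) ⟩
          ι (a !ᵐ) * ∑ (choices (Vec.map partitions ks)) (λ λs → ⟦ a ≟ Vec.map length λs ⟧ * expansion λs) ∎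

      -- The factor `a !ᵐ` from the power cancels the denominator in `genFun`; exchanging the sums
      -- then lets the bracket fix `a`.
      substitute-coefficient : ∀ i → substitute (genFun evaluation μ) s (λ j → genFun-1-withoutConstantTerm evaluation (ν j)) i ≈
        sumOver i (λ λs → expansion λs * moment evaluation μ (Vec.map length λs))
      substitute-coefficient i = begin
        ∑ N (λ a → genFun evaluation μ a * (s ^ᵐ a) i)
          ≈⟨ ∑-cong N (λ {a} _ → summand a) ⟩
        ∑ N (λ a → ∑ (decompositions n i) (λ ks → ∑ (choices (Vec.map partitions ks)) (λ λs → ⟦ a ≟ Vec.map length λs ⟧ * (expansion λs * M a))))
          ≈⟨ ∑-comm N (decompositions n i) _ ⟩
        ∑ (decompositions n i) (λ ks → ∑ N (λ a → ∑ (choices (Vec.map partitions ks)) (λ λs → ⟦ a ≟ Vec.map length λs ⟧ * (expansion λs * M a))))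
          -- For fixed `λs` one `a` survives, its vector of lengths, which `∣lengths∣≤` places
          -- inside the truncated range `N`.
          ≈⟨ ∑-cong (decompositions n i) (λ {ks} ks∈ → trans (∑-comm N (choices (Vec.map partitions ks)) _)
               (∑-cong (choices (Vec.map partitions ks)) (λ {λs} λs∈ →
                 ∑-⟦⟧ _≟_ (degree≤-unique n ∣ i ∣) (degree≤-complete _ (∣lengths∣≤ n i ks∈ λs∈)) (λ a → expansion λs * M a)))) ⟩
        sumOver i (λ λs → expansion λs * M (Vec.map length λs)) ∎
        where
        N : List (MultiIndex n)
        N = degree≤ n ∣ i ∣
        M : MultiIndex n → Carrier
        M = moment evaluation μ
        summand : ∀ a → genFun evaluation μ a * (s ^ᵐ a) i ≈
          sumOver i (λ λs → ⟦ a ≟ Vec.map length λs ⟧ * (expansion λs * M a))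
        summand a = begin
          genFun evaluation μ a * (s ^ᵐ a) i
            ≈⟨ *-cong (genFun-coefficient μ a) (^ᵐ-coefficient a i) ⟩
          M a * (1 / a !ᵐ) {{a !ᵐ≢0}} * (ι (a !ᵐ) * S)
            ≈⟨ solve 4 (λ p q r t → (p :* q) :* (r :* t) ⊜ (r :* q) :* (t :* p)) refl (M a) _ (ι (a !ᵐ)) S ⟩
          ι (a !ᵐ) * (1 / a !ᵐ) {{a !ᵐ≢0}} * (S * M a)
            ≈⟨ trans (*-congʳ (ι-1/ (a !ᵐ) {{a !ᵐ≢0}})) (*-identityˡ _) ⟩
          S * M a
            ≈⟨ trans (∑-distribʳ _ (decompositions n i) _) (∑-cong (decompositions n i) (λ {ks} _ →
                 trans (∑-distribʳ _ (choices (Vec.map partitions ks)) _)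
                   (∑-cong (choices (Vec.map partitions ks)) (λ _ → *-assoc _ _ _)))) ⟩
          sumOver i (λ λs → ⟦ a ≟ Vec.map length λs ⟧ * (expansion λs * M a)) ∎
          where
          S : Carrier
          S = sumOver i (λ λs → ⟦ a ≟ Vec.map length λs ⟧ * expansion λs)

theorem3p5 : ∀ {c ℓ₁ ℓ₂ a} (R : HeytingField c ℓ₁ ℓ₂) (char0 : CharacteristicZero R) (A : Set a) →
    let open UmbralCalculus R char0 A in
    (E : Evaluation) (n m : ℕ) (μ : Vector Monomial n) (ν : Fin n → Vector Monomial m) →
    auxGenFun E μ ν
    ≈ˢ substitute (genFun E μ) (λ j → genFun-1 E (ν j)) (λ j → genFun-1-withoutConstantTerm E (ν j))
theorem3p5 R char0 A E n m μ ν i = trans (auxGenFun-coefficient E μ ν i) (sym (substitute-coefficient E μ ν i))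
  where
  open CommutativeRing (HeytingCommutativeRing.commutativeRing (HeytingField.heytingCommutativeRing R)) using (trans; sym)
  open AuxiliaryUmbra R char0 A
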